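{- Let $p$ be a prime, $e\geq 0$ an integer, and let $G$ and $H$ be finite abelian $p$-groups of exponent $\le p^e$. With $r_k$, $\tilde r_k$, $\alpha_p$ and $\delta_G$ as defined in the context, the following hold for all integers $n$: (a) $\displaystyle \delta_G(n)=-\alpha_p(G)+\sum_{k=1}^e\tilde r_k(G)\left\{\frac{n-1}{p^k}\right\}$ and $\delta_{G\times H}(n)=\delta_G(n)+\delta_H(n)$. (b) $\displaystyle \alpha_p(G)=\sum_{k=1}^e\tilde r_k(G)\,\frac{p^k-1}{p^k}$ and $\alpha_p(G\times H)=\alpha_p(G)+\alpha_p(H)$. (c) $\delta_G(1)=-\alpha_p(G)\le\delta_G(n)\le 0=\delta_G(0)$.
   Context: For a finite abelian $p$-group $G$ (written multiplicatively) and $k\ge1$: $r_k(G):=\dim_{\mathbb{F}_p}\left(G^{p^{k-1}}/G^{p^k}\right)$ and $\tilde r_k(G):=r_k(G)-r_{k+1}(G)$. For integers $a$ and $b\ge1$ write $\left\{\frac ab\right\}:=\frac ab-\left\lfloor\frac ab\right\rfloor$. For $m\in\mathbb{Z}$ and $k\ge1$: $$\delta(m,k):=\left\{\frac{m}{p^k}\right\}-\left\{\frac{m}{p^{k-1}}\right\}.$$ For $G$ of exponent dividing $p^e$ and $n\in\mathbb{Z}$: $$\alpha_p(G):=\sum_{k=1}^e\frac{p-1}{p^k}r_k(G),\qquad\delta_G(n):=-\alpha_p(G)+\sum_{k=1}^e r_k(G)\,\delta(n-1,k).$$ (These do not depend on the choice of $e$ with $\exp(G)\mid p^e$, since $r_k(G)=0$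 for $p^k>\exp(G)$.) -}

module Defs where

open import Algebra.Bundles using (AbelianGroup; Ring; CommutativeRing)
import Algebra.Construct.DirectProduct as DirectProduct
import Algebra.Definitions.RawMonoid
open import Algebra.Module.Bundles using (LeftModule)
import Algebra.Properties.AbelianGroup
import Algebra.Properties.CommutativeMonoid.Mult
import Algebra.Properties.CommutativeSemigroup
import Algebra.Properties.Monoid.Sum
open import Data.Fin.Base as Fin using (Fin; zero; suc; toℕ)
import Data.Fin.Properties as Fin
open import Data.Integer.Base as ℤ using (ℤ; +_; -[1+_])
open import Data.Integer.Divisibility.Signed as ℤ∣ using (_∣_; divides)
import Data.Integer.DivMod as ℤ
import Data.Integer.Properties as ℤ
open import Data.Integer.Tactic.RingSolver using (solve-∀)
open import Data.Nat.Base as ℕ using (ℕ; zero; suc; NonZero; pred)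
import Data.Nat.Coprimality as Coprimality
import Data.Nat.GCD as GCD
open import Data.Nat.Induction using (<-wellFounded)
open import Data.Nat.Primality using (Prime; prime⇒nonZero)
import Data.Nat.Properties as ℕ
open import Data.Product.Base using (Σ; ∃-syntax; _×_; _,_; proj₁; proj₂)
open import Data.Product.Function.NonDependent.Setoid using (_×-inverse_)
open import Data.Product.Relation.Binary.Pointwise.NonDependent using (Pointwise-≡↔≡)
open import Data.Rational.Base as ℚ using (ℚ; _/_; floor)
import Data.Rational.Properties as ℚ
open import Data.Vec.Functional as Vector using (Vector)
open import Function.Base using (_∘_)
open import Function.Bundles using (Inverse)
import Function.Construct.Composition as Compose
import Function.Construct.Symmetry as Symmetry
open import Induction.WellFounded using (Acc; acc)
open import Level using (Level; _⊔_; 0ℓ) renaming (suc to lsuc)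
open import Relation.Binary.PropositionalEquality as ≡ using (_≡_; cong; subst)
import Relation.Binary.Reasoning.Setoid
open import Relation.Nullary using (¬_; Dec; yes; no; contradiction)
open import Relation.Nullary.Decidable using (map′)

private
  variable
    c ℓ c′ ℓ′ a ℓa m ℓm : Level

module _ (p : ℕ) where

  infix 4 _≈ₚ_

  record _≈ₚ_ (i j : ℤ) : Set where
    constructor mod
    field ∣-diff : + p ∣ i ℤ.- j

  ≡⇒≈ₚ : ∀ {i j} → i ≡ j → i ≈ₚ j
  ≡⇒≈ₚ {i} ≡.refl = mod (divides (+ 0) (ℤ.+-inverseʳ i))

  private
    sym-lem : ∀ i j → j ℤ.- i ≡ ℤ.- (i ℤ.- j)
    sym-lem = solve-∀

    trans-lem : ∀ i j k → i ℤ.- k ≡ (i ℤ.- j) ℤ.+ (j ℤ.- k)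
    trans-lem = solve-∀

    +-lem : ∀ i j k l → (i ℤ.+ k) ℤ.- (j ℤ.+ l) ≡ (i ℤ.- j) ℤ.+ (k ℤ.- l)
    +-lem = solve-∀

    *-lem : ∀ i j k l → (i ℤ.* k) ℤ.- (j ℤ.* l) ≡ k ℤ.* (i ℤ.- j) ℤ.+ j ℤ.* (k ℤ.- l)
    *-lem = solve-∀

    neg-lem : ∀ i j → (ℤ.- i) ℤ.- (ℤ.- j) ≡ ℤ.- (i ℤ.- j)
    neg-lem = solve-∀

  -- The ring ℤ/pℤ, with representatives in ℤ compared modulo p.
  𝔽 : CommutativeRing 0ℓ 0ℓ
  𝔽 = record
    { Carrier = ℤ ; _≈_ = _≈ₚ_ ; _+_ = ℤ._+_ ; _*_ = ℤ._*_ ; -_ = ℤ.-_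
    ; 0# = + 0 ; 1# = + 1
    ; isCommutativeRing = record
      { isRing = record
        { +-isAbelianGroup = record
          { isGroup = record
            { isMonoid = record
              { isSemigroup = record
                { isMagma = record
                  { isEquivalence = record
                    { refl  = ≡⇒≈ₚ ≡.refl
                    ; sym   = λ { {i} {j} (mod i≈j) →
                        mod (subst (+ p ∣_) (≡.sym (sym-lem i j)) (ℤ∣.∣m⇒∣-m i≈j)) }
                    ; trans = λ { {i} {j} {k} (mod i≈j) (mod j≈k) →
                        mod (subst (+ p ∣_) (≡.sym (trans-lem i j k)) (ℤ∣.∣m∣n⇒∣m+n i≈j j≈k)) }
                    }
                  ; ∙-cong = λ { {i} {j} {k} {l} (mod i≈j) (mod k≈l) →
                      mod (subst (+ p ∣_) (≡.sym (+-lem i j k l)) (ℤ∣.∣m∣n⇒∣m+n i≈j k≈l)) }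
                  }
                ; assoc = λ i j k → ≡⇒≈ₚ (ℤ.+-assoc i j k)
                }
              ; identity = (≡⇒≈ₚ ∘ ℤ.+-identityˡ) , (≡⇒≈ₚ ∘ ℤ.+-identityʳ)
              }
            ; inverse = (≡⇒≈ₚ ∘ ℤ.+-inverseˡ) , (≡⇒≈ₚ ∘ ℤ.+-inverseʳ)
            ; ⁻¹-cong = λ { {i} {j} (mod i≈j) →
                mod (subst (+ p ∣_) (≡.sym (neg-lem i j)) (ℤ∣.∣m⇒∣-m i≈j)) }
            }
          ; comm = λ i j → ≡⇒≈ₚ (ℤ.+-comm i j)
          }
        ; *-cong = λ { {i} {j} {k} {l} (mod i≈j) (mod k≈l) →
            mod (subst (+ p ∣_) (≡.sym (*-lem i j k l))
              (ℤ∣.∣m∣n⇒∣m+n (ℤ∣.∣n⇒∣m*n k i≈j) (ℤ∣.∣n⇒∣m*n j k≈l))) }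
        ; *-assoc = λ i j k → ≡⇒≈ₚ (ℤ.*-assoc i j k)
        ; *-identity = (≡⇒≈ₚ ∘ ℤ.*-identityˡ) , (≡⇒≈ₚ ∘ ℤ.*-identityʳ)
        ; distrib = (λ i j k → ≡⇒≈ₚ (ℤ.*-distribˡ-+ i j k))
                  , (λ i j k → ≡⇒≈ₚ (ℤ.*-distribʳ-+ i j k))
        }
      ; *-comm = λ i j → ≡⇒≈ₚ (ℤ.*-comm i j)
      }
    }

  𝔽-ring : Ring 0ℓ 0ℓ
  𝔽-ring = CommutativeRing.ring 𝔽

module _ {R : Ring a ℓa} (M : LeftModule R m ℓm) where
  open Ring R using (Carrier; _≈_; 0#)
  open LeftModule M

  lincomb : ∀ {d} → Vector Carrier d → Vector Carrierᴹ d → Carrierᴹ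
  lincomb a b = sum λ i → a i *ₗ b i
    where open Algebra.Properties.Monoid.Sum +ᴹ-monoid using (sum)

  record IsBasis {d} (b : Vector Carrierᴹ d) : Set (a ⊔ ℓa ⊔ m ⊔ ℓm) where
    field
      independent : ∀ a → lincomb a b ≈ᴹ 0ᴹ → ∀ i → a i ≈ 0#
      spanning    : ∀ v → ∃[ a ] lincomb a b ≈ᴹ v

  HasDimension : ℕ → Set (a ⊔ ℓa ⊔ m ⊔ ℓm)
  HasDimension d = ∃[ b ] IsBasis {d} b

module FiniteBasis {p : ℕ} ⦃ pp : Prime p ⦄ (V : LeftModule (𝔽-ring p) m ℓm) where
  open LeftModule V
  private
    module 𝔽ₚ = CommutativeRing (𝔽 p)
    module GP = Algebra.Properties.AbelianGroup +ᴹ-abelianGroup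
    open Relation.Binary.Reasoning.Setoid ≈ᴹ-setoid

    instance
      p≢0 : NonZero p
      p≢0 = prime⇒nonZero pp

  %-≈ₚ : ∀ a → _≈ₚ_ p (+ (a ℤ.%ℕ p)) a
  %-≈ₚ a = 𝔽ₚ.sym (mod (divides (a ℤ./ℕ p) (≡.trans
    (cong (ℤ._- + (a ℤ.%ℕ p)) (ℤ.a≡a%ℕn+[a/ℕn]*n a p))
    (lem (+ (a ℤ.%ℕ p)) ((a ℤ./ℕ p) ℤ.* + p)))))
    where
    lem : ∀ x y → (x ℤ.+ y) ℤ.- x ≡ y
    lem = solve-∀

  _≈0? : ∀ a → Dec (_≈ₚ_ p a (+ 0))
  a ≈0? = map′ mod _≈ₚ_.∣-diff (+ p ℤ∣.∣? (a ℤ.- + 0))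

  inverse : ∀ a → ¬ (_≈ₚ_ p a (+ 0)) → ∃[ a⁻¹ ] _≈ₚ_ p (a⁻¹ ℤ.* a) (+ 1)
  inverse a a≉0 = go (Coprimality.coprime-Bézout (Coprimality.sym (Coprimality.prime⇒coprime pp {{≢0}} (ℤ.n%ℕd<d a p))))
    where
    s = a ℤ.%ℕ p
    ≢0 : NonZero s
    ≢0 with s in eq
    ... | zero  = contradiction
                    (𝔽ₚ.trans (𝔽ₚ.sym (%-≈ₚ a)) (𝔽ₚ.reflexive (cong +_ eq))) a≉0
    ... | suc _ = _
    lem⁺ : ∀ y q → (+ 1 ℤ.+ y ℤ.* q) ℤ.- + 1 ≡ y ℤ.* q
    lem⁺ = solve-∀
    lem⁻ : ∀ x s → (ℤ.- x) ℤ.* s ℤ.- + 1 ≡ ℤ.- (+ 1 ℤ.+ x ℤ.* s)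
    lem⁻ = solve-∀
    push : ∀ x y z w → 1 ℕ.+ x ℕ.* y ≡ z ℕ.* w → + 1 ℤ.+ + x ℤ.* + y ≡ + z ℤ.* + w
    push x y z w eq = ≡.trans (cong (λ t → + 1 ℤ.+ t) (≡.sym (ℤ.pos-* x y)))
                        (≡.trans (cong +_ eq) (ℤ.pos-* z w))
    go : GCD.Bézout.Identity 1 s p → _
    go (GCD.Bézout.+- x y eq) = + x ,
      𝔽ₚ.trans
        (𝔽ₚ.*-cong (𝔽ₚ.refl {+ x}) (𝔽ₚ.sym (%-≈ₚ a)))
        (mod (divides (+ y) (≡.trans (cong (ℤ._- + 1) (≡.sym (push y p x s eq)))
           (lem⁺ (+ y) (+ p)))))
    go (GCD.Bézout.-+ x y eq) = ℤ.- + x ,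
      𝔽ₚ.trans
        (𝔽ₚ.*-cong (𝔽ₚ.refl {ℤ.- + x}) (𝔽ₚ.sym (%-≈ₚ a)))
        (mod (divides (ℤ.- + y) (≡.trans (lem⁻ (+ x) (+ s))
           (≡.trans (cong ℤ.-_ (push x s y p eq)) (ℤ.neg-distribˡ-* (+ y) (+ p))))))

  Span : ∀ {d} → Vector Carrierᴹ d → Carrierᴹ → Set ℓm
  Span b v = ∃[ a ] lincomb V a b ≈ᴹ v

  Span-resp : ∀ {d} {b : Vector Carrierᴹ d} {v w} → v ≈ᴹ w → Span b v → Span b w
  Span-resp v≈w (a , eq) = a , ≈ᴹ-trans eq v≈w

  lincomb-scale : ∀ {d} s (a : Vector ℤ d) b → lincomb V (λ i → s ℤ.* a i) b ≈ᴹ s *ₗ lincomb V a b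
  lincomb-scale {zero}  s a b = ≈ᴹ-sym (*ₗ-zeroʳ s)
  lincomb-scale {suc d} s a b = begin
    (s ℤ.* a zero) *ₗ b zero +ᴹ lincomb V (λ i → s ℤ.* a (suc i)) (b ∘ suc)
      ≈⟨ +ᴹ-cong (*ₗ-assoc _ _ _) (lincomb-scale s (a ∘ suc) (b ∘ suc)) ⟩
    s *ₗ (a zero *ₗ b zero) +ᴹ s *ₗ lincomb V (a ∘ suc) (b ∘ suc)
      ≈⟨ *ₗ-distribˡ _ _ _ ⟨
    s *ₗ lincomb V a b ∎

  module _ (_≟ᴹ_ : ∀ v w → Dec (v ≈ᴹ w)) where
    span? : ∀ {d} (b : Vector Carrierᴹ d) v → Dec (Span b v)
    span? {zero}  b v = map′ (λ eq → (λ ()) , eq) proj₂ (0ᴹ ≟ᴹ v)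
    span? {suc d} b v = map′ to from
      (Fin.any? λ (i : Fin p) → span? (b ∘ suc) (v +ᴹ -ᴹ (+ toℕ i *ₗ b zero)))
      where
      to : (∃[ i ] Span (b ∘ suc) (v +ᴹ -ᴹ (+ toℕ {p} i *ₗ b zero))) → Span b v
      to (i , a , eq) = (+ toℕ i Vector.∷ a) , (begin
        + toℕ i *ₗ b zero +ᴹ lincomb V a (b ∘ suc)           ≈⟨ +ᴹ-congˡ eq ⟩
        + toℕ i *ₗ b zero +ᴹ (v +ᴹ -ᴹ (+ toℕ i *ₗ b zero))  ≈⟨ +ᴹ-assoc _ _ _ ⟨
        + toℕ i *ₗ b zero +ᴹ v +ᴹ -ᴹ (+ toℕ i *ₗ b zero)    ≈⟨ GP.xyx⁻¹≈y _ _ ⟩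
        v ∎)
      from : Span b v → ∃[ i ] Span (b ∘ suc) (v +ᴹ -ᴹ (+ toℕ {p} i *ₗ b zero))
      from (a , eq) = i , a ∘ suc , (begin
        w                                            ≈⟨ GP.xyx⁻¹≈y _ _ ⟨
        x +ᴹ w +ᴹ -ᴹ x                               ≈⟨ +ᴹ-cong eq (-ᴹ‿cong x≈) ⟩
        v +ᴹ -ᴹ (+ toℕ i *ₗ b zero)                  ∎)
        where
        i = Fin.fromℕ< (ℤ.n%ℕd<d (a zero) p)
        x = a zero *ₗ b zero
        w = lincomb V (a ∘ suc) (b ∘ suc)
        x≈ : x ≈ᴹ + toℕ i *ₗ b zero
        x≈ = *ₗ-cong (𝔽ₚ.sym
               (subst (λ t → _≈ₚ_ p (+ t) (a zero)) (≡.sym (Fin.toℕ-fromℕ< _)) (%-≈ₚ (a zero))))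
               ≈ᴹ-refl

    Independent : ∀ {d} → Vector Carrierᴹ d → Set ℓm
    Independent b = ∀ a → lincomb V a b ≈ᴹ 0ᴹ → ∀ i → _≈ₚ_ p (a i) (+ 0)

    extend : ∀ {d} (b : Vector Carrierᴹ d) v → Independent b → ¬ Span b v →
             Independent (v Vector.∷ b)
    extend b v indep v∉ a eq with a zero ≈0?
    ... | yes a₀≈0 = λ { zero → a₀≈0 ; (suc i) → indep (a ∘ suc) (begin
              lincomb V (a ∘ suc) b                        ≈⟨ +ᴹ-identityˡ _ ⟨
              0ᴹ +ᴹ lincomb V (a ∘ suc) b                  ≈⟨ +ᴹ-congʳ (*ₗ-zeroˡ v) ⟨
              + 0 *ₗ v +ᴹ lincomb V (a ∘ suc) b            ≈⟨ +ᴹ-congʳ (*ₗ-cong a₀≈0 ≈ᴹ-refl) ⟨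
              a zero *ₗ v +ᴹ lincomb V (a ∘ suc) b         ≈⟨ eq ⟩
              0ᴹ                                           ∎) i }
    ... | no  a₀≉0 with inverse (a zero) a₀≉0
    ...   | s , sa≈1 = contradiction
              ((λ i → (ℤ.- s) ℤ.* a (suc i)) , (begin
                lincomb V (λ i → (ℤ.- s) ℤ.* a (suc i)) b
                  ≈⟨ lincomb-scale (ℤ.- s) (a ∘ suc) b ⟩
                (ℤ.- s) *ₗ lincomb V (a ∘ suc) b
                  ≈⟨ GP.inverseˡ-unique _ _ (begin
                      (ℤ.- s) *ₗ lincomb V (a ∘ suc) b +ᴹ s *ₗ lincomb V (a ∘ suc) b
                        ≈⟨ *ₗ-distribʳ _ _ _ ⟨
                      (ℤ.- s ℤ.+ s) *ₗ lincomb V (a ∘ suc) b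
                        ≈⟨ *ₗ-cong (𝔽ₚ.-‿inverseˡ s) ≈ᴹ-refl ⟩
                      + 0 *ₗ lincomb V (a ∘ suc) b  ≈⟨ *ₗ-zeroˡ _ ⟩
                      0ᴹ ∎) ⟩
                -ᴹ (s *ₗ lincomb V (a ∘ suc) b)
                  ≈⟨ GP.inverseˡ-unique _ _ (begin
                      v +ᴹ s *ₗ lincomb V (a ∘ suc) b
                        ≈⟨ +ᴹ-congʳ (*ₗ-identityˡ v) ⟨
                      + 1 *ₗ v +ᴹ s *ₗ lincomb V (a ∘ suc) b
                        ≈⟨ +ᴹ-congʳ (*ₗ-cong sa≈1 ≈ᴹ-refl) ⟨
                      (s ℤ.* a zero) *ₗ v +ᴹ s *ₗ lincomb V (a ∘ suc) b
                        ≈⟨ +ᴹ-congʳ (*ₗ-assoc _ _ _) ⟩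
                      s *ₗ (a zero *ₗ v) +ᴹ s *ₗ lincomb V (a ∘ suc) b
                        ≈⟨ *ₗ-distribˡ _ _ _ ⟨
                      s *ₗ lincomb V a (v Vector.∷ b)
                        ≈⟨ *ₗ-cong (𝔽ₚ.refl {s}) eq ⟩
                      s *ₗ 0ᴹ  ≈⟨ *ₗ-zeroʳ s ⟩
                      0ᴹ ∎) ⟨
                v ∎))
              v∉

    weaken : ∀ {d} (b : Vector Carrierᴹ d) v {w} → Span b w → Span (v Vector.∷ b) w
    weaken b v {w} (a , eq) = (+ 0 Vector.∷ a) , (begin
      + 0 *ₗ v +ᴹ lincomb V a b   ≈⟨ +ᴹ-cong (*ₗ-zeroˡ v) eq ⟩
      0ᴹ +ᴹ w                     ≈⟨ +ᴹ-identityˡ w ⟩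
      w                           ∎)

    here : ∀ {d} (b : Vector Carrierᴹ d) v → Span (v Vector.∷ b) v
    here b v = (+ 1 Vector.∷ λ _ → + 0) , (begin
      + 1 *ₗ v +ᴹ lincomb V (λ _ → + 0) b  ≈⟨ +ᴹ-cong (*ₗ-identityˡ v) (zeros b) ⟩
      v +ᴹ 0ᴹ                              ≈⟨ +ᴹ-identityʳ v ⟩
      v                                    ∎)
      where
      zeros : ∀ {d} (b : Vector Carrierᴹ d) → lincomb V (λ _ → + 0) b ≈ᴹ 0ᴹ
      zeros {zero}  b = ≈ᴹ-refl
      zeros {suc d} b = ≈ᴹ-trans (+ᴹ-cong (*ₗ-zeroˡ _) (zeros (b ∘ suc))) (+ᴹ-identityʳ _)

    greedy : ∀ {N} (f : Vector Carrierᴹ N) →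
             ∃[ d ] Σ (Vector Carrierᴹ d) λ b → Independent b × ∀ i → Span b (f i)
    greedy {zero}  f = 0 , (λ ()) , (λ _ _ ()) , λ ()
    greedy {suc N} f with greedy (f ∘ suc)
    ... | d , b , indep , spans with span? b (f zero)
    ...   | yes f₀∈ = d , b , indep , λ { zero → f₀∈ ; (suc i) → spans i }
    ...   | no  f₀∉ = suc d , (f zero Vector.∷ b) , extend b (f zero) indep f₀∉ ,
              λ { zero → here b (f zero) ; (suc i) → weaken b (f zero) (spans i) }

    basis-exists : ∀ {N} (f : Vector Carrierᴹ N) → (∀ v → ∃[ i ] f i ≈ᴹ v) → ∃[ d ] HasDimension V d
    basis-exists f f-onto with greedy f
    ... | d , b , indep , spans = d , b , record
      { independent = indep
      ; spanning    = λ v → Span-resp (proj₂ (f-onto v)) (spans (proj₁ (f-onto v)))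
      }

module Powers (A : AbelianGroup c ℓ) where
  open AbelianGroup A
  private
    module P = Algebra.Properties.AbelianGroup A
    module × = Algebra.Properties.CommutativeMonoid.Mult commutativeMonoid
    module S = Algebra.Properties.CommutativeSemigroup commutativeSemigroup
    open Relation.Binary.Reasoning.Setoid setoid

  infixr 8 _^_ _^ᶻ_

  _^_ : Carrier → ℕ → Carrier
  x ^ n = n ×.× x

  _^ᶻ_ : Carrier → ℤ → Carrier
  x ^ᶻ (+ n)    = x ^ n
  x ^ᶻ -[1+ n ] = (x ^ suc n) ⁻¹

  record IsPower (m : ℕ) (g : Carrier) : Set (c ⊔ ℓ) where
    constructor power
    field
      root   : Carrier
      root^m : root ^ m ≈ g

  ∙-^ : ∀ n x y → (x ∙ y) ^ n ≈ x ^ n ∙ y ^ n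
  ∙-^ n x y = ×.×-distrib-+ x y n

  ε-^ : ∀ n → ε ^ n ≈ ε
  ε-^ zero    = refl
  ε-^ (suc n) = trans (identityˡ _) (ε-^ n)

  ⁻¹-^ : ∀ n x → (x ⁻¹) ^ n ≈ (x ^ n) ⁻¹
  ⁻¹-^ n x = P.inverseˡ-unique _ _ (begin
    (x ⁻¹) ^ n ∙ x ^ n  ≈⟨ ∙-^ n (x ⁻¹) x ⟨
    (x ⁻¹ ∙ x) ^ n      ≈⟨ ×.×-congʳ n (inverseˡ x) ⟩
    ε ^ n               ≈⟨ ε-^ n ⟩
    ε                   ∎)

  ^ᶻ-cong : ∀ i {x y} → x ≈ y → x ^ᶻ i ≈ y ^ᶻ i
  ^ᶻ-cong (+ n)    eq = ×.×-congʳ n eq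
  ^ᶻ-cong -[1+ n ] eq = ⁻¹-cong (×.×-congʳ (suc n) eq)

  ∙-^ᶻ : ∀ i x y → (x ∙ y) ^ᶻ i ≈ x ^ᶻ i ∙ y ^ᶻ i
  ∙-^ᶻ (+ n)    x y = ∙-^ n x y
  ∙-^ᶻ -[1+ n ] x y = trans (⁻¹-cong (∙-^ (suc n) x y)) (sym (P.⁻¹-∙-comm _ _))

  ε-^ᶻ : ∀ i → ε ^ᶻ i ≈ ε
  ε-^ᶻ (+ n)    = ε-^ n
  ε-^ᶻ -[1+ n ] = trans (⁻¹-cong (ε-^ (suc n))) P.ε⁻¹≈ε

  ⊖-^ᶻ : ∀ x m n → x ^ᶻ (m ℤ.⊖ n) ≈ x ^ m ∙ (x ^ n) ⁻¹
  ⊖-^ᶻ x zero    zero    = sym (inverseʳ ε)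
  ⊖-^ᶻ x zero    (suc n) = sym (identityˡ _)
  ⊖-^ᶻ x (suc m) zero    = sym (trans (∙-congˡ P.ε⁻¹≈ε) (identityʳ _))
  ⊖-^ᶻ x (suc m) (suc n) = begin
    x ^ᶻ (suc m ℤ.⊖ suc n)               ≡⟨ cong (x ^ᶻ_) (ℤ.[1+m]⊖[1+n]≡m⊖n m n) ⟩
    x ^ᶻ (m ℤ.⊖ n)                       ≈⟨ ⊖-^ᶻ x m n ⟩
    x ^ m ∙ (x ^ n) ⁻¹                   ≈⟨ identityˡ _ ⟨
    ε ∙ (x ^ m ∙ (x ^ n) ⁻¹)             ≈⟨ ∙-congʳ (inverseʳ x) ⟨
    (x ∙ x ⁻¹) ∙ (x ^ m ∙ (x ^ n) ⁻¹)    ≈⟨ S.interchange x (x ⁻¹) _ _ ⟩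
    (x ∙ x ^ m) ∙ (x ⁻¹ ∙ (x ^ n) ⁻¹)    ≈⟨ ∙-congˡ (P.⁻¹-∙-comm _ _) ⟩
    (x ∙ x ^ m) ∙ (x ∙ x ^ n) ⁻¹         ∎

  ^ᶻ-+ : ∀ x i j → x ^ᶻ (i ℤ.+ j) ≈ x ^ᶻ i ∙ x ^ᶻ j
  ^ᶻ-+ x (+ m)    (+ n)    = ×.×-homo-+ x m n
  ^ᶻ-+ x (+ m)    -[1+ n ] = ⊖-^ᶻ x m (suc n)
  ^ᶻ-+ x -[1+ m ] (+ n)    = trans (⊖-^ᶻ x n (suc m)) (comm _ _)
  ^ᶻ-+ x -[1+ m ] -[1+ n ] = begin
    (x ^ suc (suc (m ℕ.+ n))) ⁻¹          ≡⟨ cong (λ k → (x ^ suc k) ⁻¹) (ℕ.+-suc m n) ⟨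
    (x ^ (suc m ℕ.+ suc n)) ⁻¹            ≈⟨ ⁻¹-cong (×.×-homo-+ x (suc m) (suc n)) ⟩
    (x ^ suc m ∙ x ^ suc n) ⁻¹            ≈⟨ P.⁻¹-∙-comm _ _ ⟨
    (x ^ suc m) ⁻¹ ∙ (x ^ suc n) ⁻¹       ∎

  ^ᶻ-neg : ∀ x i → x ^ᶻ (ℤ.- i) ≈ (x ^ᶻ i) ⁻¹
  ^ᶻ-neg x i = P.inverseˡ-unique _ _ (trans (sym (^ᶻ-+ x (ℤ.- i) i))
    (reflexive (cong (x ^ᶻ_) (ℤ.+-inverseˡ i))))

  ^ᶻ-*⁺ : ∀ x n j → x ^ᶻ (+ n ℤ.* j) ≈ (x ^ᶻ j) ^ n
  ^ᶻ-*⁺ x zero    j = reflexive (cong (x ^ᶻ_) (ℤ.*-zeroˡ j))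
  ^ᶻ-*⁺ x (suc n) j = begin
    x ^ᶻ (+ suc n ℤ.* j)        ≡⟨ cong (x ^ᶻ_) (ℤ.suc-* (+ n) j) ⟩
    x ^ᶻ (j ℤ.+ + n ℤ.* j)      ≈⟨ ^ᶻ-+ x j (+ n ℤ.* j) ⟩
    x ^ᶻ j ∙ x ^ᶻ (+ n ℤ.* j)   ≈⟨ ∙-congˡ (^ᶻ-*⁺ x n j) ⟩
    x ^ᶻ j ∙ (x ^ᶻ j) ^ n       ∎

  ^ᶻ-* : ∀ x i j → x ^ᶻ (i ℤ.* j) ≈ (x ^ᶻ j) ^ᶻ i
  ^ᶻ-* x (+ n)    j = ^ᶻ-*⁺ x n j
  ^ᶻ-* x -[1+ n ] j = begin
    x ^ᶻ (-[1+ n ] ℤ.* j)       ≡⟨ cong (x ^ᶻ_) (ℤ.neg-distribˡ-* (+ suc n) j) ⟨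
    x ^ᶻ (ℤ.- (+ suc n ℤ.* j))  ≈⟨ ^ᶻ-neg x (+ suc n ℤ.* j) ⟩
    (x ^ᶻ (+ suc n ℤ.* j)) ⁻¹   ≈⟨ ⁻¹-cong (^ᶻ-*⁺ x (suc n) j) ⟩
    ((x ^ᶻ j) ^ suc n) ⁻¹       ∎

  ^-^ᶻ : ∀ x m i → (x ^ᶻ i) ^ m ≈ (x ^ m) ^ᶻ i
  ^-^ᶻ x m i = begin
    (x ^ᶻ i) ^ m       ≈⟨ ^ᶻ-* x (+ m) i ⟨
    x ^ᶻ (+ m ℤ.* i)   ≡⟨ cong (x ^ᶻ_) (ℤ.*-comm (+ m) i) ⟩
    x ^ᶻ (i ℤ.* + m)   ≈⟨ ^ᶻ-* x i (+ m) ⟩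
    (x ^ m) ^ᶻ i       ∎

  module _ {m : ℕ} where
    IsPower-resp : ∀ {g h} → g ≈ h → IsPower m g → IsPower m h
    IsPower-resp g≈h (power x eq) = power x (trans eq g≈h)

    IsPower-ε : IsPower m ε
    IsPower-ε = power ε (ε-^ m)

    IsPower-∙ : ∀ {g h} → IsPower m g → IsPower m h → IsPower m (g ∙ h)
    IsPower-∙ (power x xᵐ≈g) (power y yᵐ≈h) =
      power (x ∙ y) (trans (∙-^ m x y) (∙-cong xᵐ≈g yᵐ≈h))

    IsPower-⁻¹ : ∀ {g} → IsPower m g → IsPower m (g ⁻¹)
    IsPower-⁻¹ (power x xᵐ≈g) = power (x ⁻¹) (trans (⁻¹-^ m x) (⁻¹-cong xᵐ≈g))

    IsPower-^ᶻ : ∀ {g} i → IsPower m g → IsPower m (g ^ᶻ i)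
    IsPower-^ᶻ i (power x xᵐ≈g) = power (x ^ᶻ i) (trans (^-^ᶻ x m i) (^ᶻ-cong i xᵐ≈g))

  record IsExponent (N : ℕ) : Set (c ⊔ ℓ) where
    field
      positive     : NonZero N
      annihilating : ∀ x → x ^ N ≈ ε
      least        : ∀ M → .{{NonZero M}} → (∀ x → x ^ M ≈ ε) → N ℕ.≤ M

  -- The group Aᵐ / Aᵖᵐ, written additively, as an 𝔽ₚ-vector space: the
  -- scalar i acts by raising to the i-th power.
  powerQuotient : (p m : ℕ) → LeftModule (𝔽-ring p) (c ⊔ ℓ) (c ⊔ ℓ)
  powerQuotient p m = record
    { Carrierᴹ = Σ Carrier (IsPower m)
    ; _≈ᴹ_     = λ g h → IsPower (p ℕ.* m) (proj₁ g ∙ proj₁ h ⁻¹)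
    ; _+ᴹ_     = λ { (g , gᵐ) (h , hᵐ) → g ∙ h , IsPower-∙ gᵐ hᵐ }
    ; _*ₗ_     = λ { i (g , gᵐ) → g ^ᶻ i , IsPower-^ᶻ i gᵐ }
    ; 0ᴹ       = ε , IsPower-ε
    ; -ᴹ_      = λ { (g , gᵐ) → g ⁻¹ , IsPower-⁻¹ gᵐ }
    ; isLeftModule = record
      { isLeftSemimodule = record
        { +ᴹ-isCommutativeMonoid = record
          { isMonoid = record
            { isSemigroup = record
              { isMagma = record
                { isEquivalence = record
                  { refl  = ≈⇒ refl
                  ; sym   = λ g~h → IsPower-resp (P.⁻¹-anti-homo‿- _ _) (IsPower-⁻¹ g~h)
                  ; trans = λ g~h h~k → IsPower-resp (telescope _ _ _) (IsPower-∙ g~h h~k)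
                  }
                ; ∙-cong = λ g~g′ h~h′ → IsPower-resp
                    (trans (S.interchange _ _ _ _) (∙-congˡ (P.⁻¹-∙-comm _ _)))
                    (IsPower-∙ g~g′ h~h′)
                }
              ; assoc = λ _ _ _ → ≈⇒ (assoc _ _ _)
              }
            ; identity = (λ _ → ≈⇒ (identityˡ _)) , (λ _ → ≈⇒ (identityʳ _))
            }
          ; comm = λ _ _ → ≈⇒ (comm _ _)
          }
        ; isPreleftSemimodule = record
          { *ₗ-cong      = λ { {i} {j} {g , gᵐ} {h , _} i≈j g~h → *-cong′ {i} {j} g h gᵐ i≈j g~h }
          ; *ₗ-zeroˡ     = λ _ → ≈⇒ refl
          ; *ₗ-distribʳ  = λ { (g , _) i j → ≈⇒ (^ᶻ-+ g i j) }
          ; *ₗ-identityˡ = λ { (g , _) → ≈⇒ (identityʳ g) }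
          ; *ₗ-assoc     = λ { i j (g , _) → ≈⇒ (^ᶻ-* g i j) }
          ; *ₗ-zeroʳ     = λ i → ≈⇒ (ε-^ᶻ i)
          ; *ₗ-distribˡ  = λ { i (g , _) (h , _) → ≈⇒ (∙-^ᶻ i g h) }
          }
        }
      ; -ᴹ‿cong    = λ g~h → IsPower-resp (sym (P.⁻¹-∙-comm _ _)) (IsPower-⁻¹ g~h)
      ; -ᴹ‿inverse = (λ _ → ≈⇒ (inverseˡ _)) , (λ _ → ≈⇒ (inverseʳ _))
      }
    }
    where
    ≈⇒ : ∀ {g h} → g ≈ h → IsPower (p ℕ.* m) (g ∙ h ⁻¹)
    ≈⇒ g≈h = IsPower-resp (sym (P.x≈y⇒x∙y⁻¹≈ε g≈h)) IsPower-ε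

    telescope : ∀ g h k → (g ∙ h ⁻¹) ∙ (h ∙ k ⁻¹) ≈ g ∙ k ⁻¹
    telescope g h k = begin
      (g ∙ h ⁻¹) ∙ (h ∙ k ⁻¹)  ≈⟨ assoc _ _ _ ⟨
      ((g ∙ h ⁻¹) ∙ h) ∙ k ⁻¹  ≈⟨ ∙-congʳ (P.//-rightDividesˡ h g) ⟩
      g ∙ k ⁻¹                 ∎

    *-cong′ : ∀ {i j} g h → IsPower m g → _≈ₚ_ p i j → IsPower (p ℕ.* m) (g ∙ h ⁻¹) →
              IsPower (p ℕ.* m) (g ^ᶻ i ∙ (h ^ᶻ j) ⁻¹)
    *-cong′ {i} {j} g h (power x xᵐ≈g) (mod (divides q i-j≡qp)) g~h =
      IsPower-resp (telescope _ (g ^ᶻ j) _) (IsPower-∙ gⁱ~gʲ gʲ~hʲ)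
      where
      gⁱ~gʲ : IsPower (p ℕ.* m) (g ^ᶻ i ∙ (g ^ᶻ j) ⁻¹)
      gⁱ~gʲ = power (x ^ᶻ q) (begin
        (x ^ᶻ q) ^ (p ℕ.* m)       ≈⟨ ^-^ᶻ x (p ℕ.* m) q ⟩
        (x ^ (p ℕ.* m)) ^ᶻ q       ≈⟨ ^ᶻ-cong q (×.×-assocˡ x p m) ⟨
        ((x ^ m) ^ p) ^ᶻ q         ≈⟨ ^ᶻ-cong q (×.×-congʳ p xᵐ≈g) ⟩
        (g ^ p) ^ᶻ q               ≈⟨ ^ᶻ-* g q (+ p) ⟨
        g ^ᶻ (q ℤ.* + p)           ≡⟨ cong (g ^ᶻ_) i-j≡qp ⟨
        g ^ᶻ (i ℤ.- j)             ≈⟨ ^ᶻ-+ g i (ℤ.- j) ⟩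
        g ^ᶻ i ∙ g ^ᶻ (ℤ.- j)      ≈⟨ ∙-congˡ (^ᶻ-neg g j) ⟩
        g ^ᶻ i ∙ (g ^ᶻ j) ⁻¹       ∎)
      gʲ~hʲ : IsPower (p ℕ.* m) (g ^ᶻ j ∙ (h ^ᶻ j) ⁻¹)
      gʲ~hʲ = IsPower-resp (begin
        (g ∙ h ⁻¹) ^ᶻ j            ≈⟨ ∙-^ᶻ j g (h ⁻¹) ⟩
        g ^ᶻ j ∙ (h ⁻¹) ^ᶻ j       ≈⟨ ∙-congˡ (P.inverseˡ-unique _ _ (begin
          (h ⁻¹) ^ᶻ j ∙ h ^ᶻ j  ≈⟨ ∙-^ᶻ j (h ⁻¹) h ⟨
          (h ⁻¹ ∙ h) ^ᶻ j       ≈⟨ ^ᶻ-cong j (inverseˡ h) ⟩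
          ε ^ᶻ j                ≈⟨ ε-^ᶻ j ⟩
          ε                     ∎)) ⟩
        g ^ᶻ j ∙ (h ^ᶻ j) ⁻¹       ∎) (IsPower-^ᶻ j g~h)

record FiniteAbelianPGroup (p : ℕ) c ℓ : Set (lsuc (c ⊔ ℓ)) where
  field
    abelianGroup : AbelianGroup c ℓ

  open AbelianGroup abelianGroup public
  open Powers abelianGroup public

  field
    size        : ℕ
    enumeration : Inverse (≡.setoid (Fin size)) setoid
    isPGroup    : ∀ x → ∃[ k ] x ^ (p ℕ.^ k) ≈ ε

  element : Fin size → Carrier
  element = Inverse.to enumeration

  element-onto : ∀ x → ∃[ i ] element i ≈ x
  element-onto x = Inverse.from enumeration x , Inverse.strictlyInverseˡ enumeration x

  _≟_ : ∀ x y → Dec (x ≈ y)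
  x ≟ y = map′
    (λ eq → trans (sym (Inverse.strictlyInverseˡ enumeration x))
              (trans (reflexive (cong element eq)) (Inverse.strictlyInverseˡ enumeration y)))
    (Inverse.from-cong enumeration)
    (Inverse.from enumeration x Fin.≟ Inverse.from enumeration y)

  annihilates? : ∀ M → Dec (∀ x → x ^ M ≈ ε)
  annihilates? M = map′
    (λ f x → let i , eq = element-onto x in
             trans (^ᶻ-cong (+ M) (sym eq)) (f i))
    (λ f i → f (element i))
    (Fin.all? λ i → (element i ^ M) ≟ ε)

  isPower? : ∀ m g → Dec (IsPower m g)
  isPower? m g = map′
    (λ { (i , eq) → power (element i) eq })
    (λ { (power x eq) → let i , eq′ = element-onto x in
                        i , trans (^ᶻ-cong (+ m) eq′) eq })
    (Fin.any? λ i → (element i ^ m) ≟ g)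

  ^-annihilated-+ : ∀ x a b → x ^ (p ℕ.^ a) ≈ ε → x ^ (p ℕ.^ (b ℕ.+ a)) ≈ ε
  ^-annihilated-+ x a b eq = begin
    x ^ (p ℕ.^ (b ℕ.+ a))            ≡⟨ cong (x ^_) (ℕ.^-distribˡ-+-* p b a) ⟩
    x ^ (p ℕ.^ b ℕ.* p ℕ.^ a)        ≈⟨ ×.×-assocˡ x (p ℕ.^ b) (p ℕ.^ a) ⟨
    (x ^ (p ℕ.^ a)) ^ (p ℕ.^ b)      ≈⟨ ^ᶻ-cong (+ (p ℕ.^ b)) eq ⟩
    ε ^ (p ℕ.^ b)                    ≈⟨ ε-^ (p ℕ.^ b) ⟩
    ε                                ∎
    where
    open Relation.Binary.Reasoning.Setoid setoid
    module × = Algebra.Properties.CommutativeMonoid.Mult commutativeMonoid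

  annihilated-by-p^ : ∃[ k ] ∀ x → x ^ (p ℕ.^ k) ≈ ε
  annihilated-by-p^ =
    let k , f = go element in
    k , λ x → let i , eq = element-onto x in trans (^ᶻ-cong (+ (p ℕ.^ k)) (sym eq)) (f i)
    where
    go : ∀ {N} (g : Vector Carrier N) → ∃[ k ] ∀ i → g i ^ (p ℕ.^ k) ≈ ε
    go {zero}  g = 0 , λ ()
    go {suc N} g with isPGroup (g zero) | go (g ∘ suc)
    ... | a , eq | b , f = b ℕ.+ a , λ
      { zero    → ^-annihilated-+ (g zero) a b eq
      ; (suc i) → subst (λ k → g (suc i) ^ (p ℕ.^ k) ≈ ε) (ℕ.+-comm a b)
                    (^-annihilated-+ (g (suc i)) b a (f i)) }

  exponent-exists : .{{NonZero p}} → ∃[ N ] IsExponent N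
  exponent-exists with annihilated-by-p^
  ... | k , f = search (p ℕ.^ k) (<-wellFounded (p ℕ.^ k)) (ℕ.m^n≢0 p k) f
    where
    search : ∀ M → Acc ℕ._<_ M → NonZero M → (∀ x → x ^ M ≈ ε) → ∃[ N ] IsExponent N
    search (suc M) (acc rs) _ f with ℕ.anyUpTo? (λ j → annihilates? (suc j)) M
    ... | yes (j , j<M , h) = search (suc j) (rs (ℕ.s≤s j<M)) _ h
    ... | no  none          = suc M , record
      { positive     = _
      ; annihilating = f
      ; least        = λ { (suc L) h → ℕ.≮⇒≥ λ L<M → none (L , ℕ.s≤s⁻¹ L<M , h) }
      }

module _ {p : ℕ} ⦃ pp : Prime p ⦄ where
  private instance
    p≢0 : NonZero p
    p≢0 = prime⇒nonZero pp

  module _ (G : FiniteAbelianPGroup p c ℓ) where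
    open FiniteAbelianPGroup G

    exponent : ℕ
    exponent = proj₁ exponent-exists

    dimension-exists : ∀ m → ∃[ d ] HasDimension (powerQuotient p m) d
    dimension-exists m = FiniteBasis.basis-exists (powerQuotient p m)
      (λ g h → isPower? (p ℕ.* m) (proj₁ g ∙ proj₁ h ⁻¹))
      (λ i → element i ^ m , power (element i) refl)
      (λ { (g , power x xᵐ≈g) → let i , eq = element-onto x in
           i , IsPower-resp (sym (x≈y⇒x∙y⁻¹≈ε (trans (^ᶻ-cong (+ m) eq) xᵐ≈g))) IsPower-ε })
      where open Algebra.Properties.AbelianGroup abelianGroup using (x≈y⇒x∙y⁻¹≈ε)

    -- The size of a basis of Gᵐ / Gᵖᵐ for m = pᵏ⁻¹; all its bases have this size.
    -- The instance argument restricts r and r̃ to k ≥ 1.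
    r : (k : ℕ) → .{{NonZero k}} → ℕ
    r (suc j) = proj₁ (dimension-exists (p ℕ.^ j))

    r̃ : (k : ℕ) → .{{NonZero k}} → ℤ
    r̃ k = + r k ℤ.- + r (suc k)

  infixr 7 _×ᴳ_

  _×ᴳ_ : FiniteAbelianPGroup p c ℓ → FiniteAbelianPGroup p c′ ℓ′ →
         FiniteAbelianPGroup p (c ⊔ c′) (ℓ ⊔ ℓ′)
  G ×ᴳ H = record
    { abelianGroup = DirectProduct.abelianGroup G.abelianGroup H.abelianGroup
    ; size         = G.size ℕ.* H.size
    ; enumeration  = Compose.inverse
        (Compose.inverse Fin.*↔× (Symmetry.inverse Pointwise-≡↔≡))
        (G.enumeration ×-inverse H.enumeration)
    ; isPGroup     = λ { (x , y) →
        let a , xᵖᵃ≈ε = G.isPGroup x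
            b , yᵖᵇ≈ε = H.isPGroup y
            n = p ℕ.^ (b ℕ.+ a)
            eq₁ , eq₂ = ^-× n x y
        in b ℕ.+ a
         , G.trans eq₁ (G.^-annihilated-+ x a b xᵖᵃ≈ε)
         , H.trans eq₂ (subst (λ k → y H.^ (p ℕ.^ k) H.≈ H.ε) (ℕ.+-comm a b)
             (H.^-annihilated-+ y b a yᵖᵇ≈ε)) }
    }
    where
    module G = FiniteAbelianPGroup G
    module H = FiniteAbelianPGroup H
    module G×H = AbelianGroup (DirectProduct.abelianGroup G.abelianGroup H.abelianGroup)
    open Powers (DirectProduct.abelianGroup G.abelianGroup H.abelianGroup) using (_^_)

    ^-× : ∀ n x y → (x , y) ^ n G×H.≈ (x G.^ n , y H.^ n)
    ^-× zero    x y = G×H.refl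
    ^-× (suc n) x y = G×H.∙-cong {x , y} G×H.refl (^-× n x y)

-- ∑ₖ e f is the sum of f k over 1 ≤ k ≤ e.
∑ₖ : (e : ℕ) → ((k : ℕ) → .{{NonZero k}} → ℚ) → ℚ
∑ₖ e f = sum {e} λ i → f (suc (toℕ i))
  where open Algebra.Definitions.RawMonoid ℚ.+-0-rawMonoid using (sum)

-- The library's fracPart truncates towards 0, so it is not this function on
-- negative rationals.
frac : ℚ → ℚ
frac q = q ℚ.- floor q / 1

-- a /[ p ^ k ] is the rational number a / pᵏ.
infixl 7 _/[_^_]

_/[_^_] : ℤ → (p : ℕ) → ⦃ Prime p ⦄ → ℕ → ℚ
_/[_^_] a p ⦃ pp ⦄ k = _/_ a (p ℕ.^ k) {{ℕ.m^n≢0 p k {{prime⇒nonZero pp}}}}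

δ : (p : ℕ) → ⦃ Prime p ⦄ → ℤ → (k : ℕ) → .{{NonZero k}} → ℚ
δ p m k = frac (m /[ p ^ k ]) ℚ.- frac (m /[ p ^ pred k ])

module _ {p : ℕ} ⦃ _ : Prime p ⦄ where

  α : ℕ → FiniteAbelianPGroup p c ℓ → ℚ
  α e G = ∑ₖ e λ k → (+ p ℤ.- + 1) /[ p ^ k ] ℚ.* (+ r G k / 1)

  δᴳ : ℕ → FiniteAbelianPGroup p c ℓ → ℤ → ℚ
  δᴳ e G n = ℚ.- α e G ℚ.+ (∑ₖ e λ k → (+ r G k / 1) ℚ.* δ p (n ℤ.- + 1) k)

{-# OPTIONS --safe #-}
module Submission where

-- Both δ(m,k) and (p−1)/pᵏ are differences F(k) − F(k−1) with F(0) = 0, for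
-- F(k) = {m/pᵏ} and F(k) = (pᵏ−1)/pᵏ.  Since r_{e+1}(G) = 0, summation by
-- parts turns Σ rₖ(F(k) − F(k−1)) into Σ r̃ₖ F(k).  The p-th power map
-- G^{pᵏ⁻¹}/G^{pᵏ} → G^{pᵏ}/G^{pᵏ⁺¹} is onto, so r̃ₖ ≥ 0, and the bounds follow
-- from 0 ≤ {m/pᵏ} ≤ (pᵏ−1)/pᵏ, with equality at m = 0 and m = −1 respectively.
-- Additivity is that of dimensions, as the quotients of G × H split.

open import Defs
open import Algebra.Bundles using (AbelianGroup; Ring; CommutativeRing)
import Algebra.Construct.DirectProduct as DirectProduct
open import Algebra.Module.Bundles using (LeftModule)
import Algebra.Module.Construct.DirectProduct as ModuleProduct
import Algebra.Properties.AbelianGroup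
import Algebra.Properties.CommutativeMonoid.Mult
import Algebra.Properties.CommutativeMonoid.Sum
open import Data.Fin.Base as Fin using (Fin; zero; suc; toℕ; _↑ˡ_; _↑ʳ_)
import Data.Fin.Properties as Fin
open import Data.Integer.Base as ℤ using (ℤ; +_; -[1+_])
open import Data.Integer.Divisibility.Signed as ℤ∣ using (_∣_; divides)
import Data.Integer.DivMod as ℤ
import Data.Integer.Properties as ℤ
open import Data.Integer.Tactic.RingSolver using (solve-∀)
open import Data.Nat.Base as ℕ using (ℕ; zero; suc; NonZero)
import Data.Nat.Divisibility as ℕ∣
import Data.Nat.DivMod as ℕ
import Data.Nat.GCD as ℕ
open import Data.Nat.Primality using (Prime; prime⇒nonZero; prime⇒nonTrivial; euclidsLemma)
import Data.Nat.Properties as ℕ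
open import Data.Product.Base using (∃-syntax; _×_; _,_; proj₁; proj₂)
open import Data.Rational.Base as ℚ using (ℚ; _/_; _+_; _*_; -_; _-_; _≤_; 0ℚ; toℚᵘ; floor)
import Data.Rational.Properties as ℚ
open import Data.Rational.Solver using (module +-*-Solver)
import Data.Rational.Unnormalised.Base as ℚᵘ
import Data.Rational.Unnormalised.Properties as ℚᵘ
open import Data.Sum.Base using (_⊎_; inj₁; inj₂)
open import Data.Vec.Functional as Vector using (Vector; _++_)
import Data.Vec.Functional.Properties as Vector
open import Function.Base using (_∘_)
open import Level using (Level; _⊔_)
open import Relation.Binary.Bundles using (Setoid)
open import Relation.Binary.PropositionalEquality as ≡ using (_≡_; _≗_; cong; cong₂; subst)
import Relation.Binary.Reasoning.Setoid
open import Relation.Nullary using (yes; no; contradiction)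

private
  variable
    c ℓ c′ ℓ′ c″ ℓ″ a ℓa m ℓm m′ ℓm′ : Level

-- Glues the vanishing of coefficients, known on each block of a concatenated basis separately.
↑-elim : ∀ k {l} {P : Fin (k ℕ.+ l) → Set a} →
         (∀ i → P (i ↑ˡ l)) → (∀ j → P (k ↑ʳ j)) → ∀ i → P i
↑-elim zero    f g i       = g i
↑-elim (suc k) f g zero    = f zero
↑-elim (suc k) f g (suc i) = ↑-elim k (f ∘ suc) g i

-- Linear combinations and linear maps

module _ {R : Ring a ℓa} (V : LeftModule R m ℓm) where
  open Ring R using (Carrier; _≈_; 0#) renaming (_+_ to _+ᴿ_)
  open LeftModule V
  open Algebra.Properties.CommutativeMonoid.Sum +ᴹ-commutativeMonoid

  lincomb-cong : ∀ {d} {x y : Vector Carrier d} {b c : Vector Carrierᴹ d} →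
                 (∀ i → x i ≈ y i) → (∀ i → b i ≈ᴹ c i) → lincomb V x b ≈ᴹ lincomb V y c
  lincomb-cong x≈y b≈c = sum-cong-≋ λ i → *ₗ-cong (x≈y i) (b≈c i)

  lincomb-+ : ∀ {d} (x y : Vector Carrier d) (b : Vector Carrierᴹ d) →
              lincomb V (λ i → x i +ᴿ y i) b ≈ᴹ lincomb V x b +ᴹ lincomb V y b
  lincomb-+ x y b = ≈ᴹ-trans
    (sum-cong-≋ λ i → *ₗ-distribʳ (b i) (x i) (y i))
    (∑-distrib-+ (λ i → x i *ₗ b i) (λ i → y i *ₗ b i))

  lincomb-split : ∀ k {l} (x : Vector Carrier (k ℕ.+ l)) (b : Vector Carrierᴹ (k ℕ.+ l)) →
                  lincomb V x b ≈ᴹ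
                  lincomb V (x ∘ (_↑ˡ l)) (b ∘ (_↑ˡ l)) +ᴹ lincomb V (x ∘ (k ↑ʳ_)) (b ∘ (k ↑ʳ_))
  lincomb-split zero    x b = ≈ᴹ-sym (+ᴹ-identityˡ _)
  lincomb-split (suc k) x b =
    ≈ᴹ-trans (+ᴹ-congˡ (lincomb-split k (x ∘ suc) (b ∘ suc))) (≈ᴹ-sym (+ᴹ-assoc _ _ _))

module _ {R : Ring a ℓa} where

  infix 4 _⊸_

  record _⊸_ (V : LeftModule R m ℓm) (W : LeftModule R m′ ℓm′) :
             Set (a ⊔ m ⊔ ℓm ⊔ m′ ⊔ ℓm′) where
    private
      module V = LeftModule V
      module W = LeftModule W
    field
      apply  : V.Carrierᴹ → W.Carrierᴹ
      cong-≈ : ∀ {v w} → v V.≈ᴹ w → apply v W.≈ᴹ apply w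
      homo-+ : ∀ v w → apply (v V.+ᴹ w) W.≈ᴹ apply v W.+ᴹ apply w
      homo-* : ∀ s v → apply (s V.*ₗ v) W.≈ᴹ s W.*ₗ apply v

    -- Zero is zero times itself, so this follows from compatibility with scalars.
    homo-0 : apply V.0ᴹ W.≈ᴹ W.0ᴹ
    homo-0 = W.≈ᴹ-trans (cong-≈ (V.≈ᴹ-sym (V.*ₗ-zeroˡ V.0ᴹ)))
               (W.≈ᴹ-trans (homo-* _ _) (W.*ₗ-zeroˡ _))

    homo-lincomb : ∀ {d} x (b : Vector V.Carrierᴹ d) →
                   apply (lincomb V x b) W.≈ᴹ lincomb W x (apply ∘ b)
    homo-lincomb {zero}  x b = homo-0
    homo-lincomb {suc d} x b = W.≈ᴹ-trans (homo-+ _ _)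
      (W.+ᴹ-cong (homo-* _ _) (homo-lincomb (x ∘ suc) (b ∘ suc)))

  Onto : {V : LeftModule R m ℓm} {W : LeftModule R m′ ℓm′} → V ⊸ W → Set _
  Onto {W = W} f = ∀ w → ∃[ v ] _⊸_.apply f v ≈ᴹ w
    where open LeftModule W using (_≈ᴹ_)

  module _ {V : LeftModule R m ℓm} {W : LeftModule R m′ ℓm′} where
    private
      module R = Ring R
      module V = LeftModule V
      module W = LeftModule W
      V×W = ModuleProduct.leftModule V W
      module V×W = LeftModule V×W

    inl : V ⊸ V×W
    inl = record
      { apply  = λ v → v , W.0ᴹ
      ; cong-≈ = λ v≈w → v≈w , W.≈ᴹ-refl
      ; homo-+ = λ _ _ → V.≈ᴹ-refl , W.≈ᴹ-sym (W.+ᴹ-identityˡ _)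
      ; homo-* = λ s _ → V.≈ᴹ-refl , W.≈ᴹ-sym (W.*ₗ-zeroʳ s)
      }

    inr : W ⊸ V×W
    inr = record
      { apply  = λ w → V.0ᴹ , w
      ; cong-≈ = λ v≈w → V.≈ᴹ-refl , v≈w
      ; homo-+ = λ _ _ → V.≈ᴹ-sym (V.+ᴹ-identityˡ _) , W.≈ᴹ-refl
      ; homo-* = λ s _ → V.≈ᴹ-sym (V.*ₗ-zeroʳ s) , W.≈ᴹ-refl
      }

    -- The two bases, embedded by `inl` and `inr` and concatenated, form a basis: each component of
    -- a combination of them involves only one block of coefficients.
    dimension-× : ∀ {k l} → HasDimension V k → HasDimension W l → HasDimension V×W (k ℕ.+ l)
    dimension-× {k} {l} (b , b-basis) (c , c-basis) = bc , record
      { independent = λ x eq i →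
          let eqᵛ , eqʷ = V×W.≈ᴹ-trans (V×W.≈ᴹ-sym (lincomb-bc x)) eq in
          ↑-elim k (B.independent _ eqᵛ) (C.independent _ eqʷ) i
      ; spanning    = λ (v , w) →
          let x , eqᵛ = B.spanning v
              y , eqʷ = C.spanning w in
          x ++ y , V×W.≈ᴹ-trans (lincomb-bc (x ++ y))
            ( V.≈ᴹ-trans (lincomb-cong V (λ i → R.reflexive (Vector.lookup-++ˡ x y i)) (λ _ → V.≈ᴹ-refl)) eqᵛ
            , W.≈ᴹ-trans (lincomb-cong W (λ i → R.reflexive (Vector.lookup-++ʳ x y i)) (λ _ → W.≈ᴹ-refl)) eqʷ )
      }
      where
      module B = IsBasis b-basis
      module C = IsBasis c-basis
      bˡ = _⊸_.apply inl ∘ b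
      cʳ = _⊸_.apply inr ∘ c
      bc = bˡ ++ cʳ

      lincomb-bc : ∀ x → lincomb V×W x bc V×W.≈ᴹ
                   (lincomb V (x ∘ (_↑ˡ l)) b , lincomb W (x ∘ (k ↑ʳ_)) c)
      lincomb-bc x = V×W.≈ᴹ-trans (lincomb-split V×W k x bc) (V×W.≈ᴹ-trans
        (V×W.+ᴹ-cong
          (V×W.≈ᴹ-trans
            (lincomb-cong V×W (λ _ → R.refl) (λ i → Setoid.reflexive V×W.≈ᴹ-setoid (Vector.lookup-++ˡ bˡ cʳ i)))
            (V×W.≈ᴹ-sym (_⊸_.homo-lincomb inl _ b)))
          (V×W.≈ᴹ-trans
            (lincomb-cong V×W (λ _ → R.refl) (λ i → Setoid.reflexive V×W.≈ᴹ-setoid (Vector.lookup-++ʳ bˡ cʳ i)))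
            (V×W.≈ᴹ-sym (_⊸_.homo-lincomb inr _ c))))
        -- Each inclusion leaves a zero in the other factor.
        (V.+ᴹ-identityʳ _ , W.+ᴹ-identityˡ _))

-- Dimensions of 𝔽ₚ-vector spaces

-- Stands in for function extensionality when coefficient vectors are encoded as numbers.
funToFin-cong : ∀ {k l} {f g : Fin k → Fin l} → f ≗ g → Fin.funToFin f ≡ Fin.funToFin g
funToFin-cong {zero}  f≗g = ≡.refl
funToFin-cong {suc k} f≗g = cong₂ Fin.combine (f≗g zero) (funToFin-cong (f≗g ∘ suc))

module _ {p : ℕ} where
  private
    module 𝔽ₚ = CommutativeRing (𝔽 p)

  -- Two numbers below p differ by less than p, so a difference divisible by p is zero.
  toℕ-≈ₚ-injective : ∀ (i j : Fin p) → _≈ₚ_ p (+ toℕ i) (+ toℕ j) → i ≡ j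
  toℕ-≈ₚ-injective i j (mod p∣i-j) = Fin.toℕ-injective (ℤ.+-injective
    (ℤ.i-j≡0⇒i≡j _ _ (ℤ.∣i∣≡0⇒i≡0 (small (ℤ∣.∣⇒∣ᵤ p∣i-j)
      (ℕ.≤-<-trans
        (subst (λ z → ℤ.∣ z ∣ ℕ.≤ toℕ i ℕ.⊔ toℕ j) (≡.sym (ℤ.m-n≡m⊖n (toℕ i) (toℕ j)))
          (ℤ.∣m⊝n∣≤m⊔n (toℕ i) (toℕ j)))
        (ℕ.⊔-pres-<m (Fin.toℕ<n i) (Fin.toℕ<n j)))))))
    where
    small : ∀ {k} → p ℕ∣.∣ k → k ℕ.< p → k ≡ 0
    small {zero}  _   _   = ≡.refl
    small {suc k} p∣k k<p = contradiction k<p (ℕ.≤⇒≯ (ℕ∣.∣⇒≤ p∣k))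

  module _ {V : LeftModule (𝔽-ring p) m ℓm} where
    open LeftModule V
    open Relation.Binary.Reasoning.Setoid ≈ᴹ-setoid

    independent⇒injective : ∀ {d} {b : Vector Carrierᴹ d} →
      (∀ x → lincomb V x b ≈ᴹ 0ᴹ → ∀ i → _≈ₚ_ p (x i) (+ 0)) →
      ∀ x y → lincomb V x b ≈ᴹ lincomb V y b → ∀ i → _≈ₚ_ p (x i) (y i)
    independent⇒injective {b = b} indep x y eq i = x≈y
      where
      z = λ i → x i ℤ.- y i
      z+y : ∀ i → z i ℤ.+ y i ≡ x i
      z+y i = lem (x i) (y i)
        where
        lem : ∀ u v → (u ℤ.- v) ℤ.+ v ≡ u
        lem = solve-∀
      z≈0 : lincomb V z b ≈ᴹ 0ᴹ
      -- Adding `y` to the difference `z` recovers `x`, so adding the combination of `z` leaves that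
      -- of `y` unchanged.
      z≈0 = Algebra.Properties.AbelianGroup.identityˡ-unique +ᴹ-abelianGroup _ (lincomb V y b) (begin
        lincomb V z b +ᴹ lincomb V y b    ≈⟨ lincomb-+ V z y b ⟨
        lincomb V (λ i → z i ℤ.+ y i) b   ≈⟨ lincomb-cong V (𝔽ₚ.reflexive ∘ z+y) (λ _ → ≈ᴹ-refl) ⟩
        lincomb V x b                     ≈⟨ eq ⟩
        lincomb V y b                     ∎)
      x≈y = 𝔽ₚ.trans (𝔽ₚ.sym (𝔽ₚ.reflexive (z+y i)))
                 (𝔽ₚ.trans (𝔽ₚ.+-congʳ (indep z z≈0 i)) (𝔽ₚ.reflexive (ℤ.+-identityˡ (y i))))

    module _ ⦃ pp : Prime p ⦄ where
      private instance
        p≢0 : NonZero p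
        p≢0 = prime⇒nonZero pp

      -- Scalars are arbitrary integers compared modulo p; choosing residues turns coefficient
      -- vectors into a finite set that can be counted.
      residue : ℤ → Fin p
      residue x = Fin.fromℕ< (ℤ.n%ℕd<d x p)

      residue-≈ₚ : ∀ x → _≈ₚ_ p (+ toℕ (residue x)) x
      residue-≈ₚ x = subst (λ t → _≈ₚ_ p (+ t) x) (≡.sym (Fin.toℕ-fromℕ< _)) (FiniteBasis.%-≈ₚ V x)

      -- Coordinates embed the p^k combinations of the independent vectors
      -- into the p^l coefficient vectors of the spanning family.
      independent≤spanning : ∀ {k l} {b : Vector Carrierᴹ k} {c : Vector Carrierᴹ l} →
        (∀ x → lincomb V x b ≈ᴹ 0ᴹ → ∀ i → _≈ₚ_ p (x i) (+ 0)) →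
        (∀ v → ∃[ x ] lincomb V x c ≈ᴹ v) →
        k ℕ.≤ l
      independent≤spanning {k} {l} {b} {c} indep spans = ℕ.≮⇒≥ λ l<k →
        contradiction (ℕ.^-monoʳ-< p 1<p l<k) (ℕ.≤⇒≯ (Fin.injective⇒≤ code-injective))
        where
        1<p = ℕ.nonTrivial⇒n>1 p {{prime⇒nonTrivial pp}}

        -- The k base-p digits of a number below p^k serve as coefficients for `b`.
        digits : Fin (p ℕ.^ k) → Vector ℤ k
        digits x i = + toℕ (Fin.finToFun x i)

        coordinates : Fin (p ℕ.^ k) → Vector ℤ l
        coordinates x = proj₁ (spans (lincomb V (digits x) b))

        code : Fin (p ℕ.^ k) → Fin (p ℕ.^ l)
        code x = Fin.funToFin (residue ∘ coordinates x)

        code-injective : ∀ {x y} → code x ≡ code y → x ≡ y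
        code-injective {x} {y} eq = ≡.trans (≡.sym (Fin.funToFin-finToFin {k} {p} x))
          (≡.trans (funToFin-cong same-digits) (Fin.funToFin-finToFin {k} {p} y))
          where
          same-coordinates : ∀ j → _≈ₚ_ p (coordinates x j) (coordinates y j)
          same-coordinates j = 𝔽ₚ.trans (𝔽ₚ.sym (residue-≈ₚ (coordinates x j)))
            (𝔽ₚ.trans (𝔽ₚ.reflexive (cong (λ i → + toℕ i) (≡.trans
               (≡.sym (Fin.finToFun-funToFin (residue ∘ coordinates x) j))
               (≡.trans (cong (λ t → Fin.finToFun t j) eq)
                 (Fin.finToFun-funToFin (residue ∘ coordinates y) j)))))
             (residue-≈ₚ (coordinates y j)))

          -- Congruent coordinates over `c` give the same vector, and independence of `b` then
          -- recovers its digits.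
          same-digits : Fin.finToFun x ≗ Fin.finToFun y
          same-digits i = toℕ-≈ₚ-injective _ _
            (independent⇒injective indep (digits x) (digits y) (begin
              lincomb V (digits x) b       ≈⟨ proj₂ (spans _) ⟨
              lincomb V (coordinates x) c  ≈⟨ lincomb-cong V same-coordinates (λ _ → ≈ᴹ-refl) ⟩
              lincomb V (coordinates y) c  ≈⟨ proj₂ (spans _) ⟩
              lincomb V (digits y) b       ∎) i)

module _ {p : ℕ} ⦃ pp : Prime p ⦄ {V : LeftModule (𝔽-ring p) m ℓm}
         {W : LeftModule (𝔽-ring p) m′ ℓm′} where
  private
    module W = LeftModule W

  -- A surjection carries a basis to a spanning family, which is at least as large as any
  -- independent family of the target.
  onto⇒dimension-≤ : (f : V ⊸ W) → Onto f → ∀ {k l} → HasDimension V k → HasDimension W l → l ℕ.≤ k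
  onto⇒dimension-≤ f onto (b , b-basis) (_ , c-basis) =
    independent≤spanning {V = W} {c = apply ∘ b} (IsBasis.independent c-basis) λ w →
      let v , fv≈w = onto w
          x , eq   = IsBasis.spanning b-basis v
      in x , W.≈ᴹ-trans (W.≈ᴹ-sym (homo-lincomb x b)) (W.≈ᴹ-trans (cong-≈ eq) fv≈w)
    where open _⊸_ f

-- The empty family spans a trivial space and bounds the size of every basis.
trivial⇒dimension-zero : ∀ {p} ⦃ pp : Prime p ⦄ (V : LeftModule (𝔽-ring p) m ℓm) →
  let open LeftModule V in (∀ v → v ≈ᴹ 0ᴹ) → ∀ {k} → HasDimension V k → k ≡ 0
trivial⇒dimension-zero V trivial (_ , b-basis) = ℕ.n≤0⇒n≡0
  (independent≤spanning {V = V} {c = λ ()} (IsBasis.independent b-basis)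
    λ v → (λ ()) , LeftModule.≈ᴹ-sym V (trivial v))

-- The quotients Aᵐ / Aᵖᵐ

module PowerQuotient (A : AbelianGroup c ℓ) (p : ℕ) where
  open AbelianGroup A
  open Powers A
  private
    module P = Algebra.Properties.AbelianGroup A
    module × = Algebra.Properties.CommutativeMonoid.Mult commutativeMonoid
    open Relation.Binary.Reasoning.Setoid setoid

  ≈⇒IsPower : ∀ {m g h} → g ≈ h → IsPower m (g ∙ h ⁻¹)
  ≈⇒IsPower g≈h = IsPower-resp (sym (P.x≈y⇒x∙y⁻¹≈ε g≈h)) IsPower-ε

  private
    IsPower-^ : ∀ {m g} → IsPower m g → IsPower (p ℕ.* m) (g ^ p)
    IsPower-^ {m} {g} (power x xᵐ≈g) = power x (begin
      x ^ (p ℕ.* m)  ≈⟨ ×.×-assocˡ x p m ⟨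
      (x ^ m) ^ p    ≈⟨ ×.×-congʳ p xᵐ≈g ⟩
      g ^ p          ∎)

  -- Respects the quotients because the p-th power of a (pm)-th power is a (p(pm))-th power.
  powerMap : ∀ m → powerQuotient p m ⊸ powerQuotient p (p ℕ.* m)
  powerMap m = record
    { apply  = λ (g , gᵐ) → g ^ p , IsPower-^ gᵐ
    ; cong-≈ = λ { {g , _} {h , _} g~h →
        IsPower-resp (trans (∙-^ p g (h ⁻¹)) (∙-congˡ (⁻¹-^ p h))) (IsPower-^ g~h) }
    ; homo-+ = λ (g , _) (h , _) → ≈⇒IsPower (∙-^ p g h)
    ; homo-* = λ i (g , _) → ≈⇒IsPower (^-^ᶻ g p i)
    }

  -- A (pm)-th power is the p-th power of the m-th power of its root.
  powerMap-onto : ∀ m → Onto (powerMap m)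
  powerMap-onto m (g , power x eq) =
    (x ^ m , power x refl) , ≈⇒IsPower (trans (×.×-assocˡ x p m) eq)

  powerQuotient-trivial : ∀ m → (∀ x → x ^ m ≈ ε) →
    let open LeftModule (powerQuotient p m) in ∀ v → v ≈ᴹ 0ᴹ
  powerQuotient-trivial m xᵐ≈ε (g , power x xᵐ≈g) =
    ≈⇒IsPower (trans (sym xᵐ≈g) (xᵐ≈ε x))

-- Power quotients of a direct product

module _ (A : AbelianGroup c ℓ) (B : AbelianGroup c′ ℓ′) where
  private
    A×B = DirectProduct.abelianGroup A B
    module A   = AbelianGroup A
    module B   = AbelianGroup B
    module A×B = AbelianGroup A×B
    module PA  = Powers A
    module PB  = Powers B
    module P×  = Powers A×B

  ^-× : ∀ n x y → (x , y) P×.^ n A×B.≈ (x PA.^ n , y PB.^ n)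
  ^-× zero    x y = A×B.refl
  ^-× (suc n) x y = A×B.∙-cong {x , y} A×B.refl (^-× n x y)

  ^ᶻ-× : ∀ i x y → (x , y) P×.^ᶻ i A×B.≈ (x PA.^ᶻ i , y PB.^ᶻ i)
  ^ᶻ-× (+ n)    x y = ^-× n x y
  ^ᶻ-× -[1+ n ] x y = A×B.⁻¹-cong (^-× (suc n) x y)

  IsPower-×⁺ : ∀ {m x y} → PA.IsPower m x → PB.IsPower m y → P×.IsPower m (x , y)
  IsPower-×⁺ {m} (Powers.power u uᵐ≈x) (Powers.power v vᵐ≈y) =
    Powers.power (u , v) (A×B.trans (^-× m u v) (uᵐ≈x , vᵐ≈y))

  IsPower-×⁻ : ∀ {m x y} → P×.IsPower m (x , y) → PA.IsPower m x × PB.IsPower m y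
  IsPower-×⁻ {m} (Powers.power (u , v) eq) =
    let eqᴬ , eqᴮ = A×B.trans (A×B.sym (^-× m u v)) eq in
    Powers.power u eqᴬ , Powers.power v eqᴮ

  module _ (p m : ℕ) where
    private
      module QA = PowerQuotient A p
      module QB = PowerQuotient B p
      Q×  = Powers.powerQuotient A×B p m
      QA×QB = ModuleProduct.leftModule (Powers.powerQuotient A p m) (Powers.powerQuotient B p m)

    -- Together with `join` this gives surjections in both directions, enough to equate the
    -- dimensions by antisymmetry.
    split : Q× ⊸ QA×QB
    split = record
      { apply  = λ ((x , y) , xyᵐ) → let xᵐ , yᵐ = IsPower-×⁻ xyᵐ in (x , xᵐ) , (y , yᵐ)
      ; cong-≈ = IsPower-×⁻
      ; homo-+ = λ _ _ → QA.≈⇒IsPower A.refl , QB.≈⇒IsPower B.refl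
      ; homo-* = λ i ((x , y) , _) →
          let eqᴬ , eqᴮ = ^ᶻ-× i x y in QA.≈⇒IsPower eqᴬ , QB.≈⇒IsPower eqᴮ
      }

    split-onto : Onto split
    split-onto ((x , xᵐ) , (y , yᵐ)) =
      ((x , y) , IsPower-×⁺ xᵐ yᵐ) , QA.≈⇒IsPower A.refl , QB.≈⇒IsPower B.refl

    join : QA×QB ⊸ Q×
    join = record
      { apply  = λ ((x , xᵐ) , (y , yᵐ)) → (x , y) , IsPower-×⁺ xᵐ yᵐ
      ; cong-≈ = λ (x~x′ , y~y′) → IsPower-×⁺ x~x′ y~y′
      ; homo-+ = λ _ _ → IsPower-×⁺ (QA.≈⇒IsPower A.refl) (QB.≈⇒IsPower B.refl)
      ; homo-* = λ i ((x , _) , (y , _)) →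
          let eqᴬ , eqᴮ = ^ᶻ-× i x y in
          IsPower-×⁺ (QA.≈⇒IsPower (A.sym eqᴬ)) (QB.≈⇒IsPower (B.sym eqᴮ))
      }

    join-onto : Onto join
    join-onto ((x , y) , xyᵐ) = let xᵐ , yᵐ = IsPower-×⁻ xyᵐ in
      ((x , xᵐ) , (y , yᵐ)) , IsPower-×⁺ (QA.≈⇒IsPower A.refl) (QB.≈⇒IsPower B.refl)

-- The invariants rₖ

-- By Euclid's lemma p divides `q` or `n`; in the latter case cancelling it from `n` lowers the
-- exponent by one.
^-divisor : ∀ {p} → Prime p → ∀ k {q n} → q ℕ.* n ≡ p ℕ.^ k → q ≡ 1 ⊎ p ℕ∣.∣ q
^-divisor pp zero {q} {n} eq = inj₁ (ℕ.m*n≡1⇒m≡1 q n eq)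
^-divisor {p} pp (suc k) {q} {n} eq
  with euclidsLemma q n pp (ℕ∣.divides (p ℕ.^ k) (≡.trans eq (ℕ.*-comm p _)))
... | inj₁ p∣q = inj₂ p∣q
... | inj₂ (ℕ∣.divides n′ n≡n′p) = ^-divisor pp k (ℕ.*-cancelʳ-≡ _ _ p (begin
  q ℕ.* n′ ℕ.* p    ≡⟨ ℕ.*-assoc q n′ p ⟩
  q ℕ.* (n′ ℕ.* p)  ≡⟨ cong (q ℕ.*_) n≡n′p ⟨
  q ℕ.* n           ≡⟨ eq ⟩
  p ℕ.* p ℕ.^ k     ≡⟨ ℕ.*-comm p _ ⟩
  p ℕ.^ k ℕ.* p     ∎))
  where
  open ≡.≡-Reasoning
  instance
    p≢0 = prime⇒nonZero pp

module _ {p : ℕ} ⦃ pp : Prime p ⦄ where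
  private instance
    p≢0 : NonZero p
    p≢0 = prime⇒nonZero pp

  module _ (G : FiniteAbelianPGroup p c ℓ) where
    open FiniteAbelianPGroup G
    private
      module × = Algebra.Properties.CommutativeMonoid.Mult commutativeMonoid
      module N = IsExponent (proj₂ exponent-exists)
      N = exponent G
      instance
        N≢0 : NonZero N
        N≢0 = N.positive
      open Relation.Binary.Reasoning.Setoid setoid

    ^-multiple : ∀ q n {x} → x ^ n ≈ ε → x ^ (q ℕ.* n) ≈ ε
    ^-multiple q n {x} eq = begin
      x ^ (q ℕ.* n)  ≈⟨ ×.×-assocˡ x q n ⟨
      (x ^ n) ^ q    ≈⟨ ×.×-congʳ q eq ⟩
      ε ^ q          ≈⟨ ε-^ q ⟩
      ε              ∎

    -- The remainder of `M` modulo `N` annihilates the group as well, so minimality of `N` forces it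
    -- to be zero.
    exponent-∣ : ∀ M → (∀ x → x ^ M ≈ ε) → N ℕ∣.∣ M
    exponent-∣ M xᴹ≈ε = ℕ∣.m%n≡0⇒n∣m M N (remainder≡0 (M ℕ.% N) (ℕ.m%n<n M N) xʳ≈ε)
      where
      xʳ≈ε : ∀ x → x ^ (M ℕ.% N) ≈ ε
      xʳ≈ε x = begin
        x ^ (M ℕ.% N)                                ≈⟨ identityʳ _ ⟨
        x ^ (M ℕ.% N) ∙ ε                            ≈⟨ ∙-congˡ (^-multiple (M ℕ./ N) N (N.annihilating x)) ⟨
        x ^ (M ℕ.% N) ∙ x ^ (M ℕ./ N ℕ.* N)          ≈⟨ ×.×-homo-+ x (M ℕ.% N) _ ⟨
        x ^ (M ℕ.% N ℕ.+ M ℕ./ N ℕ.* N)              ≡⟨ cong (x ^_) (ℕ.m≡m%n+[m/n]*n M N) ⟨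
        x ^ M                                        ≈⟨ xᴹ≈ε x ⟩
        ε                                            ∎
      remainder≡0 : ∀ k → k ℕ.< N → (∀ x → x ^ k ≈ ε) → k ≡ 0
      remainder≡0 zero    _   _    = ≡.refl
      remainder≡0 (suc k) k<N xᵏ≈ε = contradiction k<N (ℕ.≤⇒≯ (N.least (suc k) xᵏ≈ε))

    -- If N ≤ pᵉ < pᵏ⁺¹ = qN, then p divides q ≠ 1, so N already divides pᵏ.
    exponent≤⇒annihilates : ∀ e → N ℕ.≤ p ℕ.^ e → ∀ x → x ^ (p ℕ.^ e) ≈ ε
    exponent≤⇒annihilates e N≤pᵉ = let k , xᵖᵏ≈ε = annihilated-by-p^ in descend k xᵖᵏ≈ε
      where
      -- The initial annihilating exponent k may exceed e; it is lowered one step at a time until k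
      -- ≤ e.
      descend : ∀ k → (∀ x → x ^ (p ℕ.^ k) ≈ ε) → ∀ x → x ^ (p ℕ.^ e) ≈ ε
      descend k xᵖᵏ≈ε with k ℕ.≤? e
      descend k xᵖᵏ≈ε | yes k≤e = λ x →
        subst (λ n → x ^ (p ℕ.^ n) ≈ ε) (ℕ.m∸n+n≡m k≤e) (^-annihilated-+ x k (e ℕ.∸ k) (xᵖᵏ≈ε x))
      descend zero    xᵖᵏ≈ε | no k≰e = contradiction ℕ.z≤n k≰e
      descend (suc k) xᵖᵏ≈ε | no k≰e with exponent-∣ _ xᵖᵏ≈ε
      ... | ℕ∣.divides q pᵏ≡qN with ^-divisor pp (suc k) {q} {N} (≡.sym pᵏ≡qN)
      ...   | inj₁ ≡.refl = contradiction
                (ℕ.≤-trans (ℕ.≤-reflexive (≡.trans pᵏ≡qN (ℕ.*-identityˡ N))) N≤pᵉ)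
                (ℕ.<⇒≱ (ℕ.^-monoʳ-< p (ℕ.nonTrivial⇒n>1 p {{prime⇒nonTrivial pp}}) (ℕ.≰⇒> k≰e)))
      ...   | inj₂ (ℕ∣.divides q′ q≡q′p) = descend k λ x →
                subst (λ n → x ^ n ≈ ε) (≡.sym pᵏ≡q′N) (^-multiple q′ N (N.annihilating x))
        where
        pᵏ≡q′N : p ℕ.^ k ≡ q′ ℕ.* N
        pᵏ≡q′N = ℕ.*-cancelˡ-≡ _ _ p (≡.trans pᵏ≡qN (≡.trans
          (cong (ℕ._* N) (≡.trans q≡q′p (ℕ.*-comm q′ p))) (ℕ.*-assoc p q′ N)))

    r-antitone : ∀ k → .{{_ : NonZero k}} → r G (suc k) ℕ.≤ r G k
    r-antitone (suc j) = onto⇒dimension-≤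
      (PowerQuotient.powerMap abelianGroup p (p ℕ.^ j)) (PowerQuotient.powerMap-onto abelianGroup p (p ℕ.^ j))
      (proj₂ (dimension-exists G (p ℕ.^ j))) (proj₂ (dimension-exists G (p ℕ.^ suc j)))

    -- `r G (suc e)` measures a quotient of the group of p^e-th powers, all of which are trivial.
    -- This kills the upper boundary term in the summation by parts.
    r-vanishes : ∀ e → N ℕ.≤ p ℕ.^ e → r G (suc e) ≡ 0
    r-vanishes e N≤pᵉ = trivial⇒dimension-zero (powerQuotient p (p ℕ.^ e))
      (PowerQuotient.powerQuotient-trivial abelianGroup p (p ℕ.^ e) (exponent≤⇒annihilates e N≤pᵉ))
      (proj₂ (dimension-exists G (p ℕ.^ e)))

  r-× : (G : FiniteAbelianPGroup p c ℓ) (H : FiniteAbelianPGroup p c′ ℓ′) →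
        ∀ k → .{{_ : NonZero k}} → r (G ×ᴳ H) k ≡ r G k ℕ.+ r H k
  r-× G H (suc j) = ℕ.≤-antisym
    (onto⇒dimension-≤ (join A B p n) (join-onto A B p n) dim-QA×QB dim-Q×)
    (onto⇒dimension-≤ (split A B p n) (split-onto A B p n) dim-Q× dim-QA×QB)
    where
    A = FiniteAbelianPGroup.abelianGroup G
    B = FiniteAbelianPGroup.abelianGroup H
    n = p ℕ.^ j
    dim-Q×    = proj₂ (dimension-exists (G ×ᴳ H) n)
    dim-QA×QB = dimension-× {V = Powers.powerQuotient A p n} {W = Powers.powerQuotient B p n}
                  (proj₂ (dimension-exists G n)) (proj₂ (dimension-exists H n))

-- Fractions

-- `_/_` reduces by the gcd; passing to unnormalised fractions lets identities be checked by
-- cross-multiplication.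
toℚᵘ-/ : ∀ i d .{{_ : NonZero d}} → toℚᵘ (i / d) ℚᵘ.≃ i ℚᵘ./ d
toℚᵘ-/ i (suc d) = ℚ.toℚᵘ-fromℚᵘ (ℚᵘ.mkℚᵘ i d)

/-≡ : ∀ i j c d .{{_ : NonZero c}} .{{_ : NonZero d}} → i ℤ.* + d ≡ j ℤ.* + c → i / c ≡ j / d
/-≡ i j (suc c) (suc d) eq = ℚ.fromℚᵘ-cong {ℚᵘ.mkℚᵘ i c} {ℚᵘ.mkℚᵘ j d} (ℚᵘ.*≡* eq)

/-+ : ∀ i j d .{{_ : NonZero d}} → i / d + j / d ≡ (i ℤ.+ j) / d
/-+ i j d@(suc _) = ℚ.toℚᵘ-injective (begin
  toℚᵘ (i / d + j / d)          ≈⟨ ℚ.toℚᵘ-homo-+ (i / d) (j / d) ⟩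
  toℚᵘ (i / d) ℚᵘ.+ toℚᵘ (j / d)  ≈⟨ ℚᵘ.+-cong (toℚᵘ-/ i d) (toℚᵘ-/ j d) ⟩
  i ℚᵘ./ d ℚᵘ.+ j ℚᵘ./ d        ≈⟨ ℚᵘ.*≡* (lem i j (+ d)) ⟩
  (i ℤ.+ j) ℚᵘ./ d              ≈⟨ toℚᵘ-/ (i ℤ.+ j) d ⟨
  toℚᵘ ((i ℤ.+ j) / d)          ∎)
  where
  open ℚᵘ.≃-Reasoning
  lem : ∀ i j d → (i ℤ.* d ℤ.+ j ℤ.* d) ℤ.* d ≡ (i ℤ.+ j) ℤ.* (d ℤ.* d)
  lem = solve-∀

/-neg : ∀ i d .{{_ : NonZero d}} → - (i / d) ≡ (ℤ.- i) / d
/-neg i d@(suc _) = ℚ.toℚᵘ-injective (begin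
  toℚᵘ (- (i / d))     ≈⟨ ℚ.toℚᵘ-homo‿- (i / d) ⟩
  ℚᵘ.- toℚᵘ (i / d)    ≈⟨ ℚᵘ.-‿cong (toℚᵘ-/ i d) ⟩
  (ℤ.- i) ℚᵘ./ d       ≈⟨ toℚᵘ-/ (ℤ.- i) d ⟨
  toℚᵘ ((ℤ.- i) / d)   ∎)
  where open ℚᵘ.≃-Reasoning

/-minus : ∀ i j d .{{_ : NonZero d}} → i / d - j / d ≡ (i ℤ.- j) / d
/-minus i j d = ≡.trans (cong (λ t → i / d + t) (/-neg j d)) (/-+ i (ℤ.- j) d)

/-mono-≤ : ∀ i j d .{{_ : NonZero d}} → i ℤ.≤ j → i / d ≤ j / d
/-mono-≤ i j d@(suc _) i≤j = ℚ.toℚᵘ-cancel-≤ (begin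
  toℚᵘ (i / d)  ≃⟨ toℚᵘ-/ i d ⟩
  i ℚᵘ./ d      ≤⟨ ℚᵘ.*≤* (ℤ.*-monoʳ-≤-nonNeg (+ d) i≤j) ⟩
  j ℚᵘ./ d      ≃⟨ toℚᵘ-/ j d ⟨
  toℚᵘ (j / d)  ∎)
  where open ℚᵘ.≤-Reasoning

0≤/ : ∀ i d .{{_ : NonZero d}} → 0ℚ ≤ + i / d
0≤/ i d = ℚ.≤-trans (ℚ.≤-reflexive (≡.sym (ℚ.0/n≡0 d))) (/-mono-≤ (+ 0) (+ i) d (ℤ.+≤+ ℕ.z≤n))

floor≡/ℕ : ∀ q → floor q ≡ ℚ.↥ q ℤ./ℕ ℚ.↧ₙ q
floor≡/ℕ q@record{} = ℤ.div-pos-is-/ℕ (ℚ.↥ q) (ℚ.↧ₙ q)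

-- The remainder of m modulo d, pinned down by congruence rather than computed,
-- so that it can be compared with the reduced fraction that floor acts on.
frac-/ : ∀ m d .{{d≢0 : NonZero d}} →
         ∃[ i ] i ℕ.< d × + d ∣ m ℤ.- + i × frac (m / d) ≡ + i / d
frac-/ m d {{d≢0}} = i , i<d , divides f m-i≡fd , (begin
  m / d - f / 1               ≡⟨ cong (λ t → m / d - t) (/-≡ f (f ℤ.* + d) 1 d (≡.sym (ℤ.*-identityʳ _))) ⟩
  m / d - (f ℤ.* + d) / d     ≡⟨ /-minus m (f ℤ.* + d) d ⟩
  (m ℤ.- f ℤ.* + d) / d       ≡⟨ cong (_/ d) (≡.trans (cong (ℤ._- f ℤ.* + d) m≡i+fd) (cancelʳ (+ i) (f ℤ.* + d))) ⟩
  + i / d                     ∎)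
  where
  open ≡.≡-Reasoning
  q = m / d
  N = ℚ.↥ q
  D = ℚ.↧ₙ q
  g = ℕ.gcd ℤ.∣ m ∣ d
  f = floor q
  -- Since m = Ng and d = Dg, the remainder of the reduced fraction is scaled back by the gcd.
  i = N ℤ.%ℕ D ℕ.* g

  instance
    D≢0 : NonZero D
    D≢0 = _

  d≡Dg : d ≡ D ℕ.* g
  d≡Dg = ℤ.+-injective (≡.trans (≡.sym (ℚ.↧-/ m d)) (≡.sym (ℤ.pos-* D g)))

  g≢0 : NonZero g
  g≢0 = ℕ.m*n≢0⇒n≢0 D {{≡.subst NonZero d≡Dg d≢0}}

  i<d : i ℕ.< d
  i<d = subst (i ℕ.<_) (≡.sym d≡Dg) (ℕ.*-monoˡ-< g {{g≢0}} (ℤ.n%ℕd<d N D))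

  cancelʳ : ∀ x y → (x ℤ.+ y) ℤ.- y ≡ x
  cancelʳ = solve-∀
  cancelˡ : ∀ x y → (x ℤ.+ y) ℤ.- x ≡ y
  cancelˡ = solve-∀
  expand : ∀ r f D g → (r ℤ.+ f ℤ.* D) ℤ.* g ≡ r ℤ.* g ℤ.+ f ℤ.* (D ℤ.* g)
  expand = solve-∀

  m≡i+fd : m ≡ + i ℤ.+ f ℤ.* + d
  m≡i+fd = begin
    m                                            ≡⟨ ℚ.↥-/ m d ⟨
    N ℤ.* + g                                    ≡⟨ cong (ℤ._* + g) (ℤ.a≡a%ℕn+[a/ℕn]*n N D) ⟩
    (+ (N ℤ.%ℕ D) ℤ.+ (N ℤ./ℕ D) ℤ.* + D) ℤ.* + g  ≡⟨ cong (λ t → (+ (N ℤ.%ℕ D) ℤ.+ t ℤ.* + D) ℤ.* + g) (floor≡/ℕ q) ⟨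
    (+ (N ℤ.%ℕ D) ℤ.+ f ℤ.* + D) ℤ.* + g           ≡⟨ expand (+ (N ℤ.%ℕ D)) f (+ D) (+ g) ⟩
    + (N ℤ.%ℕ D) ℤ.* + g ℤ.+ f ℤ.* (+ D ℤ.* + g)   ≡⟨ cong₂ (λ s t → s ℤ.+ f ℤ.* t) (≡.sym (ℤ.pos-* (N ℤ.%ℕ D) g)) (ℚ.↧-/ m d) ⟩
    + i ℤ.+ f ℤ.* + d                            ∎

  m-i≡fd : m ℤ.- + i ≡ f ℤ.* + d
  m-i≡fd = ≡.trans (cong (ℤ._- + i) m≡i+fd) (cancelˡ (+ i) (f ℤ.* + d))

-- Special values and bounds of fractional parts

frac-0/ : ∀ d .{{_ : NonZero d}} → frac (+ 0 / d) ≡ 0ℚ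
frac-0/ d = cong frac (ℚ.0/n≡0 d)

-- The only remainder below 1 is 0. As p^0 = 1, this is the lower boundary value for the summation
-- by parts.
frac-/1 : ∀ m → frac (m / 1) ≡ 0ℚ
frac-/1 m = let i , i<1 , _ , eq = frac-/ m 1 in
  ≡.trans eq (cong (λ t → + t / 1) (ℕ.n<1⇒n≡0 i<1))

0≤frac-/ : ∀ m d .{{_ : NonZero d}} → 0ℚ ≤ frac (m / d)
0≤frac-/ m d = let i , _ , _ , eq = frac-/ m d in subst (0ℚ ≤_) (≡.sym eq) (0≤/ i d)

frac-/-≤ : ∀ m d .{{_ : NonZero d}} → frac (m / d) ≤ (+ d ℤ.- + 1) / d
frac-/-≤ m d = let i , i<d , _ , eq = frac-/ m d in
  subst (_≤ (+ d ℤ.- + 1) / d) (≡.sym eq) (/-mono-≤ (+ i) (+ d ℤ.- + 1) d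
    (ℤ.≤-trans (ℤ.≤-reflexive (lem (+ i))) (ℤ.+-monoˡ-≤ -[1+ 0 ] (ℤ.+≤+ i<d))))
  where
  lem : ∀ i → i ≡ (+ 1 ℤ.+ i) ℤ.- + 1
  lem = solve-∀

-- The remainder i < d has d dividing 1 + i, so 1 + i = d and the bound of `frac-/-≤` is attained.
frac-‿1/ : ∀ d .{{_ : NonZero d}} → frac (-[1+ 0 ] / d) ≡ (+ d ℤ.- + 1) / d
frac-‿1/ d = let i , i<d , d∣-1-i , eq = frac-/ -[1+ 0 ] d in
  ≡.trans eq (cong (_/ d) (≡.trans (lem (+ i)) (cong (λ t → + t ℤ.- + 1) (1+i≡d i i<d d∣-1-i))))
  where
  lem : ∀ i → i ≡ (+ 1 ℤ.+ i) ℤ.- + 1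
  lem = solve-∀
  lem′ : ∀ i → + 1 ℤ.+ i ≡ ℤ.- (-[1+ 0 ] ℤ.- i)
  lem′ = solve-∀
  1+i≡d : ∀ i → i ℕ.< d → + d ∣ -[1+ 0 ] ℤ.- + i → suc i ≡ d
  1+i≡d i i<d d∣-1-i = ℕ.≤-antisym i<d (ℕ∣.∣⇒≤ (ℤ∣.∣⇒∣ᵤ
    (subst (+ d ∣_) (≡.sym (lem′ (+ i))) (ℤ∣.∣m⇒∣-m d∣-1-i))))

-- Finite sums of rationals

open Algebra.Properties.CommutativeMonoid.Sum ℚ.+-0-commutativeMonoid
  using (sum; sum-cong-≗; ∑-distrib-+; sum-replicate-zero)

-- Summands live on ℕ so that they can be shifted in inductions. With k = i + 1 this agrees with
-- `∑ₖ` by computation.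
sum< : ℕ → (ℕ → ℚ) → ℚ
sum< n f = sum {n} λ i → f (toℕ i)

sum<-cong : ∀ n (f g : ℕ → ℚ) → (∀ i → f i ≡ g i) → sum< n f ≡ sum< n g
sum<-cong n f g f≡g = sum-cong-≗ {n} λ i → f≡g (toℕ i)

sum<-+ : ∀ n (f g : ℕ → ℚ) → sum< n (λ i → f i + g i) ≡ sum< n f + sum< n g
sum<-+ n f g = ∑-distrib-+ {n} (λ i → f (toℕ i)) (λ i → g (toℕ i))

sum<-mono-≤ : ∀ n (f g : ℕ → ℚ) → (∀ i → f i ≤ g i) → sum< n f ≤ sum< n g
sum<-mono-≤ zero    f g f≤g = ℚ.≤-refl
sum<-mono-≤ (suc n) f g f≤g =
  ℚ.+-mono-≤ (f≤g 0) (sum<-mono-≤ n (λ i → f (suc i)) (λ i → g (suc i)) λ i → f≤g (suc i))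

-- Both boundary terms are kept because the induction shifts `R` and `F`, after which the initial
-- value of `F` may be nonzero.
summation-by-parts : ∀ e (R F : ℕ → ℚ) →
  sum< e (λ i → R i * (F (suc i) - F i)) + R 0 * F 0 ≡
  sum< e (λ i → (R i - R (suc i)) * F (suc i)) + R e * F e
summation-by-parts zero    R F = ≡.refl
summation-by-parts (suc e) R F = begin
  -- The first term absorbs `R 0 * F 0` and releases `R 1 * F 1`, the boundary term of the shifted
  -- sum.
  (R 0 * (F 1 - F 0) + S) + R 0 * F 0    ≡⟨ solve 5 (λ r₀ r₁ f₀ f₁ s →
      (r₀ :* (f₁ :- f₀) :+ s) :+ r₀ :* f₀ := (r₀ :- r₁) :* f₁ :+ (s :+ r₁ :* f₁)) ≡.refl
      (R 0) (R 1) (F 0) (F 1) S ⟩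
  (R 0 - R 1) * F 1 + (S + R 1 * F 1)    ≡⟨ cong (λ t → (R 0 - R 1) * F 1 + t)
      (summation-by-parts e (λ i → R (suc i)) (λ i → F (suc i))) ⟩
  (R 0 - R 1) * F 1 + (T + R (suc e) * F (suc e))  ≡⟨ ℚ.+-assoc ((R 0 - R 1) * F 1) T _ ⟨
  ((R 0 - R 1) * F 1 + T) + R (suc e) * F (suc e)  ∎
  where
  open ≡.≡-Reasoning
  open +-*-Solver
  S = sum< e λ i → R (suc i) * (F (suc (suc i)) - F (suc i))
  T = sum< e λ i → (R (suc i) - R (suc (suc i))) * F (suc (suc i))

summation-by-parts₀ : ∀ e (R F : ℕ → ℚ) → F 0 ≡ 0ℚ → R e ≡ 0ℚ →
  sum< e (λ i → R i * (F (suc i) - F i)) ≡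
  sum< e (λ i → (R i - R (suc i)) * F (suc i))
summation-by-parts₀ e R F F₀≡0 Rₑ≡0 = begin
  S                ≡⟨ ℚ.+-identityʳ S ⟨
  S + 0ℚ           ≡⟨ cong (λ t → S + t) (≡.trans (cong (R 0 *_) F₀≡0) (ℚ.*-zeroʳ (R 0))) ⟨
  S + R 0 * F 0    ≡⟨ summation-by-parts e R F ⟩
  T + R e * F e    ≡⟨ cong (λ t → T + t) (≡.trans (cong (_* F e) Rₑ≡0) (ℚ.*-zeroˡ (F e))) ⟩
  T + 0ℚ           ≡⟨ ℚ.+-identityʳ T ⟩
  T                ∎
  where
  open ≡.≡-Reasoning
  S = sum< e λ i → R i * (F (suc i) - F i)
  T = sum< e λ i → (R i - R (suc i)) * F (suc i)

sum<-weighted-+ : ∀ n (r s t : ℕ → ℕ) (F : ℕ → ℚ) → (∀ i → r i ≡ s i ℕ.+ t i) →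
  sum< n (λ i → (+ r i / 1) * F i) ≡
  sum< n (λ i → (+ s i / 1) * F i) + sum< n (λ i → (+ t i / 1) * F i)
sum<-weighted-+ n r s t F r≡s+t = ≡.trans
  (sum<-cong n (λ i → (+ r i / 1) * F i) (λ i → (+ s i / 1) * F i + (+ t i / 1) * F i) term)
  (sum<-+ n (λ i → (+ s i / 1) * F i) (λ i → (+ t i / 1) * F i))
  where
  open ≡.≡-Reasoning
  term : ∀ i → (+ r i / 1) * F i ≡ (+ s i / 1) * F i + (+ t i / 1) * F i
  term i = begin
    (+ r i / 1) * F i                      ≡⟨ cong (λ d → (+ d / 1) * F i) (r≡s+t i) ⟩
    (+ (s i ℕ.+ t i) / 1) * F i            ≡⟨ cong (_* F i) (/-+ (+ s i) (+ t i) 1) ⟨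
    (+ s i / 1 + + t i / 1) * F i          ≡⟨ ℚ.*-distribʳ-+ (F i) (+ s i / 1) (+ t i / 1) ⟩
    (+ s i / 1) * F i + (+ t i / 1) * F i  ∎

-- The functions α and δ

module _ {p : ℕ} ⦃ pp : Prime p ⦄ where
  private
    p^≢0 : ∀ k → NonZero (p ℕ.^ k)
    p^≢0 k = ℕ.m^n≢0 p k {{prime⇒nonZero pp}}

  frac-at : ℤ → ℕ → ℚ
  frac-at n k = frac ((n ℤ.- + 1) /[ p ^ k ])

  -- The largest fractional part with denominator p^k.
  top : ℕ → ℚ
  top k = (+ (p ℕ.^ k) ℤ.- + 1) /[ p ^ k ]

  -- Over the common denominator p^(k+1) the numerators are p^(k+1) - 1 and p^(k+1) - p.
  top-step : ∀ k → (+ p ℤ.- + 1) /[ p ^ suc k ] ≡ top (suc k) - top k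
  top-step k = ≡.sym (begin
    top (suc k) - top k
      ≡⟨ cong (λ t → top (suc k) - t) (/-≡ (+ q ℤ.- + 1) (+ p ℤ.* (+ q ℤ.- + 1)) q (p ℕ.* q) {{p^≢0 k}} {{p^≢0 (suc k)}}
           (≡.trans (cong ((+ q ℤ.- + 1) ℤ.*_) (ℤ.pos-* p q)) (rescale (+ p) (+ q)))) ⟩
    top (suc k) - (+ p ℤ.* (+ q ℤ.- + 1)) /[ p ^ suc k ]
      ≡⟨ /-minus (+ (p ℕ.* q) ℤ.- + 1) (+ p ℤ.* (+ q ℤ.- + 1)) (p ℕ.* q) {{p^≢0 (suc k)}} ⟩
    ((+ (p ℕ.* q) ℤ.- + 1) ℤ.- + p ℤ.* (+ q ℤ.- + 1)) /[ p ^ suc k ]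
      ≡⟨ cong (_/[ p ^ suc k ]) (≡.trans
           (cong (λ t → (t ℤ.- + 1) ℤ.- + p ℤ.* (+ q ℤ.- + 1)) (ℤ.pos-* p q)) (difference (+ p) (+ q))) ⟩
    (+ p ℤ.- + 1) /[ p ^ suc k ] ∎)
    where
    open ≡.≡-Reasoning
    q = p ℕ.^ k
    rescale : ∀ p q → (q ℤ.- + 1) ℤ.* (p ℤ.* q) ≡ (p ℤ.* (q ℤ.- + 1)) ℤ.* q
    rescale = solve-∀
    difference : ∀ p q → (p ℤ.* q ℤ.- + 1) ℤ.- p ℤ.* (q ℤ.- + 1) ≡ p ℤ.- + 1
    difference = solve-∀

  module _ (e : ℕ) (G : FiniteAbelianPGroup p c ℓ) (exp≤ : exponent G ℕ.≤ p ℕ.^ e) where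
    private
      R : ℕ → ℚ
      R i = + r G (suc i) / 1

      R̃ : ℕ → ℚ
      R̃ i = r̃ G (suc i) / 1

      0≤R̃ : ∀ i → 0ℚ ≤ R̃ i
      0≤R̃ i = /-mono-≤ (+ 0) (r̃ G (suc i)) 1 (ℤ.i≤j⇒0≤j-i (ℤ.+≤+ (r-antitone G (suc i))))

    r̃-sum : (ℕ → ℚ) → ℚ
    r̃-sum F = sum< e λ i → R̃ i * F (suc i)

    -- Common source of both r̃ formulas, with `F` taken to be `frac-at n` or `top`.
    r-by-parts : ∀ F → F 0 ≡ 0ℚ → sum< e (λ i → R i * (F (suc i) - F i)) ≡ r̃-sum F
    r-by-parts F F₀≡0 = ≡.trans
      (summation-by-parts₀ e R F F₀≡0 (cong (λ d → + d / 1) (r-vanishes G e exp≤)))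
      (sum<-cong e (λ i → (R i - R (suc i)) * F (suc i)) (λ i → R̃ i * F (suc i))
        λ i → cong (_* F (suc i)) (/-minus (+ r G (suc i)) (+ r G (suc (suc i))) 1))

    r̃-sum-cong : ∀ F F′ → (∀ k → F k ≡ F′ k) → r̃-sum F ≡ r̃-sum F′
    r̃-sum-cong F F′ F≡F′ = sum<-cong e (λ i → R̃ i * F (suc i)) (λ i → R̃ i * F′ (suc i))
      λ i → cong (R̃ i *_) (F≡F′ (suc i))

    -- The weights are nonnegative, so the bounds on `δᴳ` reduce to pointwise bounds on fractional
    -- parts.
    r̃-sum-mono : ∀ F F′ → (∀ k → F k ≤ F′ k) → r̃-sum F ≤ r̃-sum F′
    r̃-sum-mono F F′ F≤F′ = sum<-mono-≤ e (λ i → R̃ i * F (suc i)) (λ i → R̃ i * F′ (suc i))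
      λ i → ℚ.*-monoˡ-≤-nonNeg (R̃ i) {{ℚ.nonNegative (0≤R̃ i)}} (F≤F′ (suc i))

    r̃-sum-zero : r̃-sum (λ _ → 0ℚ) ≡ 0ℚ
    r̃-sum-zero = ≡.trans
      (sum<-cong e (λ i → R̃ i * 0ℚ) (λ _ → 0ℚ) λ i → ℚ.*-zeroʳ (R̃ i))
      (sum-replicate-zero e)

    δᴳ-r̃ : ∀ n → δᴳ e G n ≡ - α e G + r̃-sum (frac-at n)
    -- `δ` unfolds to the difference of two consecutive values of `frac-at n`.
    δᴳ-r̃ n = cong (λ t → - α e G + t)
      (r-by-parts (frac-at n) (frac-/1 (n ℤ.- + 1)))

    α-r̃ : α e G ≡ r̃-sum top
    α-r̃ = ≡.trans
      (sum<-cong e (λ i → (+ p ℤ.- + 1) /[ p ^ suc i ] * R i) (λ i → R i * (top (suc i) - top i))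
        λ i → ≡.trans (cong (_* R i) (top-step i)) (ℚ.*-comm (top (suc i) - top i) (R i)))
      -- p^0 computes to 1, so `top 0` computes to zero.
      (r-by-parts top ≡.refl)

    δᴳ-lower : ∀ n → - α e G ≤ δᴳ e G n
    δᴳ-lower n = begin
      - α e G              ≡⟨ ℚ.+-identityʳ _ ⟨
      - α e G + 0ℚ         ≡⟨ cong (λ t → - α e G + t) r̃-sum-zero ⟨
      - α e G + r̃-sum (λ _ → 0ℚ)
        ≤⟨ ℚ.+-monoʳ-≤ (- α e G) (r̃-sum-mono (λ _ → 0ℚ) (frac-at n) λ k → 0≤frac-/ (n ℤ.- + 1) (p ℕ.^ k) {{p^≢0 k}}) ⟩
      - α e G + r̃-sum (frac-at n)  ≡⟨ δᴳ-r̃ n ⟨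
      δᴳ e G n             ∎
      where open ℚ.≤-Reasoning

    δᴳ-upper : ∀ n → δᴳ e G n ≤ 0ℚ
    δᴳ-upper n = begin
      δᴳ e G n             ≡⟨ δᴳ-r̃ n ⟩
      - α e G + r̃-sum (frac-at n)
        ≤⟨ ℚ.+-monoʳ-≤ (- α e G) (r̃-sum-mono (frac-at n) top λ k → frac-/-≤ (n ℤ.- + 1) (p ℕ.^ k) {{p^≢0 k}}) ⟩
      - α e G + r̃-sum top  ≡⟨ cong (λ t → - α e G + t) α-r̃ ⟨
      - α e G + α e G      ≡⟨ ℚ.+-inverseˡ (α e G) ⟩
      0ℚ                   ∎
      where open ℚ.≤-Reasoning

    δᴳ-1 : δᴳ e G (+ 1) ≡ - α e G
    δᴳ-1 = begin
      δᴳ e G (+ 1)         ≡⟨ δᴳ-r̃ (+ 1) ⟩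
      - α e G + r̃-sum (frac-at (+ 1))
        -- At n = 1 the numerator n - 1 is 0.
        ≡⟨ cong (λ t → - α e G + t) (≡.trans (r̃-sum-cong (frac-at (+ 1)) (λ _ → 0ℚ) λ k → frac-0/ (p ℕ.^ k) {{p^≢0 k}}) r̃-sum-zero) ⟩
      - α e G + 0ℚ         ≡⟨ ℚ.+-identityʳ _ ⟩
      - α e G              ∎
      where open ≡.≡-Reasoning

    δᴳ-0 : δᴳ e G (+ 0) ≡ 0ℚ
    δᴳ-0 = begin
      δᴳ e G (+ 0)         ≡⟨ δᴳ-r̃ (+ 0) ⟩
      - α e G + r̃-sum (frac-at (+ 0))
        -- At n = 0 the numerator is -1, and every fractional part reaches `top`.
        ≡⟨ cong (λ t → - α e G + t) (r̃-sum-cong (frac-at (+ 0)) top λ k → frac-‿1/ (p ℕ.^ k) {{p^≢0 k}}) ⟩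
      - α e G + r̃-sum top  ≡⟨ cong (λ t → - α e G + t) α-r̃ ⟨
      - α e G + α e G      ≡⟨ ℚ.+-inverseˡ (α e G) ⟩
      0ℚ                   ∎
      where open ≡.≡-Reasoning

  -- Common shape of `α` and the sum in `δᴳ`: linear in the ranks, hence additive once they are. The
  -- weight `F i` belongs to k = i + 1.
  r-sum : ℕ → FiniteAbelianPGroup p c ℓ → (ℕ → ℚ) → ℚ
  r-sum e K F = sum< e λ i → (+ r K (suc i) / 1) * F i

  α-r : ∀ e (K : FiniteAbelianPGroup p c ℓ) → α e K ≡ r-sum e K λ i → (+ p ℤ.- + 1) /[ p ^ suc i ]
  α-r e K = sum<-cong e (λ i → w i * (+ r K (suc i) / 1)) (λ i → (+ r K (suc i) / 1) * w i)
    λ i → ℚ.*-comm (w i) (+ r K (suc i) / 1)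
    where
    w : ℕ → ℚ
    w i = (+ p ℤ.- + 1) /[ p ^ suc i ]

  -- K stands for G ×ᴳ H: keeping it abstract prevents conversion checking from
  -- unfolding the enumeration of the product.
  module Additivity (e : ℕ) (K : FiniteAbelianPGroup p c″ ℓ″)
    (G : FiniteAbelianPGroup p c ℓ) (H : FiniteAbelianPGroup p c′ ℓ′)
    (r-+ : ∀ k → .{{_ : NonZero k}} → r K k ≡ r G k ℕ.+ r H k) where

    r-sum-+ : ∀ F → r-sum e K F ≡ r-sum e G F + r-sum e H F
    r-sum-+ F = sum<-weighted-+ e (λ i → r K (suc i)) (λ i → r G (suc i)) (λ i → r H (suc i)) F
      λ i → r-+ (suc i)

    α-+ : α e K ≡ α e G + α e H
    α-+ = ≡.trans (α-r e K) (≡.trans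
      (r-sum-+ λ i → (+ p ℤ.- + 1) /[ p ^ suc i ])
      (≡.sym (cong₂ _+_ (α-r e G) (α-r e H))))

    δᴳ-+ : ∀ n → δᴳ e K n ≡ δᴳ e G n + δᴳ e H n
    δᴳ-+ n = begin
      - α e K + r-sum e K d                              ≡⟨ cong₂ (λ s t → - s + t) α-+ (r-sum-+ d) ⟩
      - (α e G + α e H) + (r-sum e G d + r-sum e H d)    ≡⟨ interchange (α e G) (α e H) (r-sum e G d) (r-sum e H d) ⟩
      (- α e G + r-sum e G d) + (- α e H + r-sum e H d)  ∎
      where
      open ≡.≡-Reasoning
      open +-*-Solver
      d : ℕ → ℚ
      d i = δ p (n ℤ.- + 1) (suc i)
      interchange : ∀ a b s t → - (a + b) + (s + t) ≡ (- a + s) + (- b + t)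
      interchange = solve 4 (λ a b s t → :- (a :+ b) :+ (s :+ t) := (:- a :+ s) :+ (:- b :+ t)) ≡.refl

mainTheorem4 : ∀ {c ℓ c′ ℓ′ : Level} (p : ℕ) ⦃ _ : Prime p ⦄ (e : ℕ)
    (G : FiniteAbelianPGroup p c ℓ) (H : FiniteAbelianPGroup p c′ ℓ′) →
    exponent G ℕ.≤ p ℕ.^ e → exponent H ℕ.≤ p ℕ.^ e →
    ∀ (n : ℤ) →
    ( δᴳ e G n ≡ - α e G + (∑ₖ e λ k → (r̃ G k / 1) * frac ((n ℤ.- + 1) /[ p ^ k ]))
    × δᴳ e (G ×ᴳ H) n ≡ δᴳ e G n + δᴳ e H n )
    × ( α e G ≡ (∑ₖ e λ k → (r̃ G k / 1) * ((+ (p ℕ.^ k) ℤ.- + 1) /[ p ^ k ]))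
    × α e (G ×ᴳ H) ≡ α e G + α e H )
    × ( δᴳ e G (+ 1) ≡ - α e G
    × - α e G ≤ δᴳ e G n
    × δᴳ e G n ≤ 0ℚ
    × δᴳ e G (+ 0) ≡ 0ℚ )
mainTheorem4 {c} {ℓ} {c′} {ℓ′} p e G H exp≤ _ n =
    (δᴳ-r̃ e G exp≤ n , G×H.δᴳ-+ n)
  , (α-r̃ e G exp≤ , G×H.α-+)
  , (δᴳ-1 e G exp≤ , δᴳ-lower e G exp≤ n , δᴳ-upper e G exp≤ n , δᴳ-0 e G exp≤)
  where
  module G×H = Additivity {c″ = c ⊔ c′} {ℓ″ = ℓ ⊔ ℓ′} e (G ×ᴳ H) G H (r-× G H)
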